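{- Let $n$ and $k$ be integers with $n \ge 2k+1 \ge 5$. Then the complement $\overline{K}(n,k)$ of the Kneser graph $K(n,k)$ satisfies Hadwiger's conjecture, that is, $$h(\overline{K}(n,k)) \ge \chi(\overline{K}(n,k)).$$
   Context: For integers $n \ge 2k+1$, the Kneser graph $K(n,k)$ has as vertices the $k$-subsets of $[n]=\{1,\dots,n\}$, two vertices being adjacent if and only if the corresponding $k$-subsets are disjoint; $\overline{K}(n,k)$ denotes its complement (two $k$-subsets are adjacent iff they intersect). For a graph $G$, $h(G)$ (the Hadwiger number) is the maximum integer $t$ such that $G$ contains the complete graph $K_t$ as a minor, and $\chi(G)$ is the chromatic number. Hadwiger's conjecture asserts $h(G)\ge\chi(G)$ for every graph $G$. -}

module Defs where

open import Data.Nat using (ℕ; _≤_)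
open import Data.Fin using (Fin)
open import Data.Fin.Subset using (Subset; _∩_; ∣_∣; Nonempty)
open import Data.Maybe using (Maybe; just)
open import Data.Product using (Σ; ∃; _×_; proj₁)
open import Relation.Binary.PropositionalEquality using (_≡_; _≢_)

record Graph : Set₁ where
  field
    V   : Set
    Adj : V → V → Set
open Graph public

KneserComplement : ℕ → ℕ → Graph
KneserComplement n k = record
  { V   = Σ (Subset n) (λ s → ∣ s ∣ ≡ k)
  ; Adj = λ s t → (proj₁ s ≢ proj₁ t) × Nonempty (proj₁ s ∩ proj₁ t)
  }

Colorable : Graph → ℕ → Set
Colorable G c = Σ (V G → Fin c) λ f → ∀ u v → Adj G u v → f u ≢ f v

IsChromaticNumber : Graph → ℕ → Set
IsChromaticNumber G c = Colorable G c × (∀ c' → Colorable G c' → c ≤ c')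

-- A walk from u to v all of whose vertices satisfy P (P u is assumed separately).
data WalkIn (G : Graph) (P : V G → Set) : V G → V G → Set where
  here : ∀ {u} → WalkIn G P u u
  step : ∀ {u w v} → Adj G u w → P w → WalkIn G P w v → WalkIn G P u v

-- K_t is a minor of G: there are t pairwise disjoint, nonempty, connected
-- branch sets B_1..B_t (encoded by β : V → Maybe (Fin t), B_i = β⁻¹(just i)),
-- with an edge between B_i and B_j for every i ≠ j.
record CompleteMinor (G : Graph) (t : ℕ) : Set where
  field
    β         : V G → Maybe (Fin t)
    nonempty  : ∀ i → ∃ λ v → β v ≡ just i
    connected : ∀ i u v → β u ≡ just i → β v ≡ just i →
                WalkIn G (λ w → β w ≡ just i) u v
    adjacent  : ∀ i j → i ≢ j →
                ∃ λ u → ∃ λ v → β u ≡ just i × β v ≡ just j × Adj G u v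

HasCompleteMinor : Graph → ℕ → Set
HasCompleteMinor G t = CompleteMinor G t

IsHadwigerNumber : Graph → ℕ → Set
IsHadwigerNumber G t = HasCompleteMinor G t × (∀ t' → HasCompleteMinor G t' → t' ≤ t)

{-# OPTIONS --safe #-}

-- Write n = qk + r with r < k and let C₁ = C(n-1,k-1). A colour class is a family
-- of disjoint k-sets, and Baranyai's theorem colours with C₁ + e = ⌈C(n,k) / q⌉
-- colours. A minor of that size: the C₁ sets through point 0 are singleton branch
-- sets, and e further branch sets avoid 0. Each of these contains a sunflower
-- through point 1, i.e. 1 joined to disjoint (k-1)-sets, so it is connected and
-- meets all other such branch sets. To meet the sets through 0, its union must
-- miss at most k - 2 of the points ≥ 1. For r ≤ 1 maximal sunflowers do. For r ≥ 2
-- shorter sunflowers are used, and each is completed by q disjoint k-sets avoiding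
-- 0 and 1, all of which it meets. Both ingredients are classes of Baranyai
-- decompositions of the sets on the remaining n - 2 points, and they are paired
-- greedily, since a sunflower misses few k-sets.
module Submission where

open import Defs
open import Data.Nat using (ℕ; _≤_; _≥_; _+_; _*_)
open import Data.Nat using (zero; suc; _∸_; _^_; _<_; z≤n; s≤s; s≤s⁻¹; _≤′_; ≤′-refl; ≤′-step; _<?_; _≤?_; _/_; _%_; NonZero; >-nonZero)
open import Data.Nat.Properties
open import Data.Nat.DivMod
  using (m%n<n; m/n≤m; m/n*n≤m; m*n/n≡m; m≡m%n+[m/n]*n; m<n⇒m/n≡0; m<n*o⇒m/o<n; /-monoˡ-≤; +-distrib-/-∣ˡ)
open import Data.Nat.Divisibility using (n∣m*n)
open import Data.Nat.Combinatorics using (_C_; nC1≡n; nCk+nC[k+1]≡[n+1]C[k+1])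
open import Data.Nat.Tactic.RingSolver using (solve-∀)
open import Data.Fin using (Fin; zero; suc; toℕ; fromℕ<; combine; remQuot; punchOut; inject≤; splitAt; join)
import Data.Fin.Properties as Fin
open import Data.Fin.Subset using (Subset; inside; outside; _∈_; _∉_; ∣_∣; _∩_; _∪_; ∁; Nonempty) renaming (⊥ to ∅)
open import Data.Fin.Subset.Properties
  using (x∈p∩q⁺; x∈p∩q⁻; x∈p∪q⁺; x∈p∪q⁻; ∉⊥; ∣p∣≤n; ∣⊥∣≡0; ∣∁p∣≡n∸∣p∣; nonempty?)
open import Data.Bool using (Bool; true; false; if_then_else_)
import Data.Bool.Properties as Bool
open import Data.List using (List; []; _∷_)
open import Data.List.Membership.Propositional using () renaming (_∈_ to _∈ˡ_; _∉_ to _∉ˡ_)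
import Data.List.Membership.DecPropositional as DecMembership
open import Data.List.Relation.Unary.Any using (here; there)
open import Data.Maybe using (Maybe; just; nothing)
open import Data.Product using (∃; _×_; _,_; proj₁; proj₂)
open import Data.Sum using (_⊎_; inj₁; inj₂)
open import Data.Sum.Properties using (inj₁-injective; inj₂-injective)
open import Data.Unit using (tt)
open import Data.Vec using ([]; _∷_; here; there)
import Data.Vec.Properties as Vec
open import Data.Vec.Functional using (updateAt)
open import Data.Vec.Functional.Properties using (updateAt-updates; updateAt-minimal)
open import Function using (_∘_; const)
open import Relation.Nullary using (Dec; yes; no; does; ¬_; ¬?; contradiction; _×-dec_; _⊎-dec_)
open import Relation.Binary.PropositionalEquality
open import Algebra.Properties.Semiring.Sum +-*-semiring
  using (sum; sum-cong-≗; ∑-comm; ∑-distrib-+; *-distribˡ-sum; *-distribʳ-sum)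

-- Since k C(n,k) = n C₁, the excess δ = C(n,k) - q C₁ satisfies k δ = r C₁, so e is about r C₁ /
-- (kq). The obstacle is the supply of petals: there are C(n-2,k-1) of them, and for r close to k -
-- 1 roughly maximal sunflowers would use up more than that. Sunflowers that cover at most (q-1)k
-- points stay within the supply for every r < k, because q(n-k) = (q-1)(n-1) + (r+q-1). The sets
-- through 0 are then met by k-sets, which have a supply of their own. In n - 2 points there is
-- space for q disjoint k-sets exactly when r ≥ 2, and they leave only r - 2 ≤ k - 3 points; hence
-- the separate treatment of r ≤ 1, where e is 0 or small enough for maximal sunflowers. A k-set
-- that misses its sunflower could disconnect the branch set. Such a set spoils only the one class
-- that contains it, so the pairing needs no more than a bound on the number of k-sets in the
-- complement of a sunflower.

private
  module FinList {c : ℕ} = DecMembership (Fin._≟_ {c})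

variable
  m n t c : ℕ
  P Q : Set

-- Rounding a weighted bipartite incidence

indicator : Dec P → ℕ
indicator d = if does d then 1 else 0

indicator-yes : (d : Dec P) → P → indicator d ≡ 1
indicator-yes (yes _) _ = refl
indicator-yes (no ¬p) p = contradiction p ¬p

indicator-no : (d : Dec P) → ¬ P → indicator d ≡ 0
indicator-no (yes p) ¬p = contradiction p ¬p
indicator-no (no _) _ = refl

indicator-≤ : (d : Dec P) (e : Dec Q) → (P → Q) → indicator d ≤ indicator e
indicator-≤ (no _) e P⇒Q = z≤n
indicator-≤ (yes p) e P⇒Q = ≤-reflexive (sym (indicator-yes e (P⇒Q p)))

sum-mono-≤ : {f g : Fin n → ℕ} → (∀ i → f i ≤ g i) → sum f ≤ sum g
sum-mono-≤ {n = zero} f≤g = z≤n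
sum-mono-≤ {n = suc n} f≤g = +-mono-≤ (f≤g zero) (sum-mono-≤ (f≤g ∘ suc))

sum-zero : {f : Fin n → ℕ} → (∀ i → f i ≡ 0) → sum f ≡ 0
sum-zero {n = zero} f≡0 = refl
sum-zero {n = suc n} f≡0 = cong₂ _+_ (f≡0 zero) (sum-zero (f≡0 ∘ suc))

sum-pick : (i : Fin n) (g : Fin n → ℕ) → sum (λ x → indicator (i Fin.≟ x) * g x) ≡ g i
sum-pick zero g =
  trans (cong₂ _+_ (*-identityˡ (g zero)) (sum-zero {f = λ x → 0 * g (suc x)} (λ _ → refl))) (+-identityʳ _)
sum-pick (suc i) g = trans (sum-cong-≗ same) (sum-pick i (g ∘ suc))
  where
  same : ∀ x → indicator (suc i Fin.≟ suc x) * g (suc x) ≡ indicator (i Fin.≟ x) * g (suc x)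
  same x with i Fin.≟ x
  ... | yes _ = refl
  ... | no _ = refl

count : (Fin t → Fin c) → Fin c → ℕ
count f p = sum λ j → indicator (f j Fin.≟ p)

count-updateAt : (f : Fin t → Fin c) (j : Fin t) (p x : Fin c) →
  count (updateAt f j (const p)) x + indicator (f j Fin.≟ x) ≡ count f x + indicator (p Fin.≟ x)
count-updateAt f zero p x = begin
  a + s + b ≡⟨ +-comm (a + s) b ⟩
  b + (a + s) ≡⟨ cong (b +_) (+-comm a s) ⟩
  b + (s + a) ≡⟨ +-assoc b s a ⟨
  b + s + a ∎
  where
  open ≡-Reasoning
  a = indicator (p Fin.≟ x)
  b = indicator (f zero Fin.≟ x)
  s = count (f ∘ suc) x
count-updateAt f (suc j) p x = begin
  h + count (updateAt (f ∘ suc) j (const p)) x + indicator (f (suc j) Fin.≟ x) ≡⟨ +-assoc h _ _ ⟩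
  h + (count (updateAt (f ∘ suc) j (const p)) x + indicator (f (suc j) Fin.≟ x))
    ≡⟨ cong (h +_) (count-updateAt (f ∘ suc) j p x) ⟩
  h + (count (f ∘ suc) x + indicator (p Fin.≟ x)) ≡⟨ +-assoc h _ _ ⟨
  h + count (f ∘ suc) x + indicator (p Fin.≟ x) ∎
  where
  open ≡-Reasoning
  h = indicator (f zero Fin.≟ x)

-- One augmenting-path step: `f` places the rows `suc j`, and row `zero` is to be inserted.
-- `Edge R p` holds if the new row, or some row now placed in a column of R, could be put into
-- column p.
module Augment (w : Fin (suc t) → Fin c → ℕ) (f : Fin t → Fin c)
               (supported : ∀ j → 0 < w (suc j) (f j)) where

  Edge : List (Fin c) → Fin c → Set
  Edge R p = 0 < w zero p ⊎ ∃ λ j → f j ∈ˡ R × 0 < w (suc j) p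

  edge? : ∀ R p → Dec (Edge R p)
  edge? R p = 0 <? w zero p ⊎-dec Fin.any? (λ j → (f j FinList.∈? R) ×-dec (0 <? w (suc j) p))

  data Reachable : List (Fin c) → Set where
    []   : Reachable []
    grow : ∀ {R p} → Reachable R → p ∉ˡ R → Edge R p → Reachable (p ∷ R)

  -- The rows moved on the way to p sit in columns visited strictly before p,
  -- so a row of column p itself is still available for the next move.
  reroute : ∀ {R p} → Reachable R → p ∈ˡ R →
    ∃ λ (f′ : Fin (suc t) → Fin c) → ∃ λ S →
      (∀ j → 0 < w j (f′ j)) ×
      (∀ x → count f′ x ≡ indicator (p Fin.≟ x) + count f x) ×
      (∀ j → f j ∉ˡ S → f′ (suc j) ≡ f j) × p ∉ˡ S × (∀ {x} → x ∈ˡ S → x ∈ˡ R)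
  reroute (grow r _ _) (there p∈R) with reroute r p∈R
  ... | f′ , S , pos , cnt , same , p∉S , S⊆R = f′ , S , pos , cnt , same , p∉S , there ∘ S⊆R
  reroute {p = p} (grow r _ (inj₁ w>0)) (here refl) = f′ , [] , pos , (λ _ → refl) , (λ _ _ → refl) , (λ ()) , λ ()
    where
    f′ : Fin (suc t) → Fin c
    f′ zero = p
    f′ (suc j) = f j
    pos : ∀ j → 0 < w j (f′ j)
    pos zero = w>0
    pos (suc j) = supported j
  reroute {p = p} (grow {R} r p∉R (inj₂ (j , fj∈R , w>0))) (here refl) with reroute r fj∈R
  ... | f′ , S , pos , cnt , same , fj∉S , S⊆R = f″ , R , pos″ , cnt″ , same″ , p∉R , there
    where
    f″ : Fin (suc t) → Fin c
    f″ = updateAt f′ (suc j) (const p)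
    pos″ : ∀ i → 0 < w i (f″ i)
    pos″ i with i Fin.≟ suc j
    ... | yes refl = subst (λ y → 0 < w (suc j) y) (sym (updateAt-updates (suc j) f′)) w>0
    ... | no i≢j = subst (λ y → 0 < w i y) (sym (updateAt-minimal i (suc j) f′ i≢j)) (pos i)
    -- The inner path adds one row to column `f j`. Moving row j on to p takes one away there, so
    -- only p gains.
    cnt″ : ∀ x → count f″ x ≡ indicator (p Fin.≟ x) + count f x
    cnt″ x = +-cancelʳ-≡ (indicator (f j Fin.≟ x)) _ _ (begin
      count f″ x + indicator (f j Fin.≟ x)
        ≡⟨ cong (λ y → count f″ x + indicator (y Fin.≟ x)) (same j fj∉S) ⟨
      count f″ x + indicator (f′ (suc j) Fin.≟ x) ≡⟨ count-updateAt f′ (suc j) p x ⟩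
      count f′ x + indicator (p Fin.≟ x) ≡⟨ cong (_+ indicator (p Fin.≟ x)) (cnt x) ⟩
      indicator (f j Fin.≟ x) + count f x + indicator (p Fin.≟ x) ≡⟨ +-assoc (indicator (f j Fin.≟ x)) _ _ ⟩
      indicator (f j Fin.≟ x) + (count f x + indicator (p Fin.≟ x))
        ≡⟨ +-comm (indicator (f j Fin.≟ x)) _ ⟩
      count f x + indicator (p Fin.≟ x) + indicator (f j Fin.≟ x)
        ≡⟨ cong (_+ indicator (f j Fin.≟ x)) (+-comm (count f x) _) ⟩
      indicator (p Fin.≟ x) + count f x + indicator (f j Fin.≟ x) ∎)
      where open ≡-Reasoning
    same″ : ∀ i → f i ∉ˡ R → f″ (suc i) ≡ f i
    same″ i fi∉R = trans
      (updateAt-minimal (suc i) (suc j) f′ λ { refl → fi∉R fj∈R })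
      (same i (fi∉R ∘ S⊆R))

  module _ (d : ℕ) .{{_ : NonZero d}} (b : Fin c → ℕ)
           (row : ∀ j → sum (w j) ≡ d) (column : ∀ p → sum (λ j → w j p) ≤ d * b p) where

    private
      into : List (Fin c) → Fin c → ℕ
      into R x = indicator (x FinList.∈? R)

    -- Double counting the weight of the rows that are zero or sit in R.
    saturated-not-closed : ∀ R → (∀ p → p ∈ˡ R → b p ≤ count f p) → ¬ (∀ p → Edge R p → p ∈ˡ R)
    saturated-not-closed R saturated closed = <-irrefl refl (*-cancelˡ-≤ d (begin
      d * suc s ≡⟨ *-distribˡ-sum d ρ ⟩
      sum (λ j → d * ρ j) ≡⟨ sum-cong-≗ (λ j → trans (*-comm d (ρ j)) (cong (ρ j *_) (sym (row j)))) ⟩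
      sum (λ j → ρ j * sum (w j)) ≡⟨ sum-cong-≗ (λ j → *-distribˡ-sum (ρ j) (w j)) ⟩
      sum (λ j → sum (λ p → ρ j * w j p)) ≤⟨ sum-mono-≤ (λ j → sum-mono-≤ (λ p → ρw≤ j p)) ⟩
      sum (λ j → sum (λ p → w j p * into R p)) ≡⟨ ∑-comm (λ j p → w j p * into R p) ⟩
      sum (λ p → sum (λ j → w j p * into R p)) ≡⟨ sum-cong-≗ (λ p → *-distribʳ-sum (into R p) (λ j → w j p)) ⟨
      sum (λ p → sum (λ j → w j p) * into R p) ≤⟨ sum-mono-≤ col≤ ⟩
      sum (λ p → d * (count f p * into R p)) ≡⟨ *-distribˡ-sum d (λ p → count f p * into R p) ⟨
      d * sum (λ p → count f p * into R p)
        ≡⟨ cong (d *_) (sum-cong-≗ λ p → *-distribʳ-sum (into R p) (λ j → indicator (f j Fin.≟ p))) ⟩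
      d * sum (λ p → sum (λ j → indicator (f j Fin.≟ p) * into R p))
        ≡⟨ cong (d *_) (∑-comm (λ p j → indicator (f j Fin.≟ p) * into R p)) ⟩
      d * sum (λ j → sum (λ p → indicator (f j Fin.≟ p) * into R p))
        ≡⟨ cong (d *_) (sum-cong-≗ λ j → sum-pick (f j) (into R)) ⟩
      d * s ∎))
      where
      open ≤-Reasoning
      ρ : Fin (suc t) → ℕ
      ρ zero = 1
      ρ (suc j) = into R (f j)
      s = sum (λ j → into R (f j))
      dominated : ∀ {P : Set} (P? : Dec P) p x → (P → 0 < x → p ∈ˡ R) → indicator P? * x ≤ x * into R p
      dominated (no _) p x _ = z≤n
      dominated (yes _) p zero _ = z≤n
      dominated (yes a) p (suc x) h rewrite indicator-yes (p FinList.∈? R) (h a (s≤s z≤n)) =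
        ≤-reflexive (*-comm 1 (suc x))
      ρw≤ : ∀ j p → ρ j * w j p ≤ w j p * into R p
      ρw≤ zero p = dominated (yes tt) p (w zero p) (λ _ w>0 → closed p (inj₁ w>0))
      ρw≤ (suc j) p = dominated (f j FinList.∈? R) p (w (suc j) p) (λ fj∈R w>0 → closed p (inj₂ (j , fj∈R , w>0)))
      col≤ : ∀ p → sum (λ j → w j p) * into R p ≤ d * (count f p * into R p)
      col≤ p with p FinList.∈? R
      ... | no _ = ≤-trans (≤-reflexive (*-zeroʳ (sum (λ j → w j p)))) z≤n
      ... | yes p∈R = begin
        sum (λ j → w j p) * 1 ≡⟨ *-identityʳ _ ⟩
        sum (λ j → w j p) ≤⟨ column p ⟩
        d * b p ≤⟨ *-monoʳ-≤ d (saturated p p∈R) ⟩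
        d * count f p ≡⟨ cong (d *_) (*-identityʳ _) ⟨
        d * (count f p * 1) ∎

    private
      outsiders : List (Fin c) → ℕ
      outsiders R = sum λ x → indicator (¬? (x FinList.∈? R))

      outsiders-∷ : ∀ {R p} → p ∉ˡ R → suc (outsiders (p ∷ R)) ≤ outsiders R
      outsiders-∷ {R} {p} p∉R = begin
        suc (outsiders (p ∷ R)) ≡⟨ cong (_+ outsiders (p ∷ R)) (sym (sum-pick p (λ _ → 1))) ⟩
        sum (λ x → indicator (p Fin.≟ x) * 1) + outsiders (p ∷ R)
          ≡⟨ ∑-distrib-+ (λ x → indicator (p Fin.≟ x) * 1) _ ⟨
        sum (λ x → indicator (p Fin.≟ x) * 1 + indicator (¬? (x FinList.∈? (p ∷ R)))) ≤⟨ sum-mono-≤ le ⟩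
        outsiders R ∎
        where
        open ≤-Reasoning
        le : ∀ x → indicator (p Fin.≟ x) * 1 + indicator (¬? (x FinList.∈? (p ∷ R))) ≤ indicator (¬? (x FinList.∈? R))
        le x with p Fin.≟ x
        ... | yes refl rewrite indicator-no (¬? (p FinList.∈? (p ∷ R))) (λ ¬p → ¬p (here refl))
                             | indicator-yes (¬? (p FinList.∈? R)) p∉R = ≤-refl
        ... | no _ = indicator-≤ (¬? (x FinList.∈? (p ∷ R))) (¬? (x FinList.∈? R)) (λ x∉ x∈ → x∉ (there x∈))

    Augmented : Set
    Augmented = ∃ λ (f′ : Fin (suc t) → Fin c) → (∀ j → 0 < w j (f′ j)) ×
      ∃ λ p → count f p < b p × (∀ x → count f′ x ≡ indicator (p Fin.≟ x) + count f x)

    augment : Augmented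
    augment = search (outsiders []) [] [] ≤-refl (λ _ ())
      where
      -- `fuel` bounds the number of unvisited columns. While all visited columns are full,
      -- `saturated-not-closed` provides an edge to a new one, and the first column with a free
      -- place ends the search.
      search : ∀ fuel R → Reachable R → outsiders R ≤ fuel → (∀ p → p ∈ˡ R → b p ≤ count f p) → Augmented
      search fuel R r enough saturated with Fin.any? (λ p → ¬? (p FinList.∈? R) ×-dec edge? R p)
      ... | no none = contradiction (λ p e → closed p e) (saturated-not-closed R saturated)
        where
        closed : ∀ p → Edge R p → p ∈ˡ R
        closed p e with p FinList.∈? R
        ... | yes p∈R = p∈R
        ... | no p∉R = contradiction (p , p∉R , e) none
      ... | yes (p , p∉R , e) with count f p <? b p
      ...   | yes free = let f′ , _ , pos , cnt , _ = reroute (grow r p∉R e) (here refl)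
                         in f′ , pos , p , free , cnt
      ...   | no full with fuel
      ...     | zero = contradiction (≤-trans (outsiders-∷ p∉R) enough) λ ()
      ...     | suc fuel′ = search fuel′ (p ∷ R) (grow r p∉R e) (s≤s⁻¹ (≤-trans (outsiders-∷ p∉R) enough)) sat′
        where
        sat′ : ∀ x → x ∈ˡ p ∷ R → b x ≤ count f x
        sat′ x (here refl) = ≮⇒≥ full
        sat′ x (there x∈R) = saturated x x∈R

-- The weights w / d form a fractional assignment of rows to columns with loads at most b. It is
-- replaced by an integral one on its support, inserting one row at a time along augmenting paths.
round : ∀ t (w : Fin t → Fin c → ℕ) d .{{_ : NonZero d}} (b : Fin c → ℕ) →
  (∀ j → sum (w j) ≡ d) → (∀ p → sum (λ j → w j p) ≤ d * b p) →
  ∃ λ (f : Fin t → Fin c) → (∀ j → 0 < w j (f j)) × (∀ p → count f p ≤ b p)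
round zero w d b row column = (λ ()) , (λ ()) , λ _ → z≤n
round (suc t) w d b row column
  with f , pos , bounded ← round t (w ∘ suc) d b (row ∘ suc) (λ p → ≤-trans (m≤n+m _ (w zero p)) (column p))
  with f′ , pos′ , p , free , cnt ← Augment.augment w f pos d b row column
  = f′ , pos′ , λ x → ≤-trans (≤-reflexive (cnt x)) (bound x)
  where
  bound : ∀ x → indicator (p Fin.≟ x) + count f x ≤ b x
  bound x with p Fin.≟ x
  ... | yes refl = free
  ... | no _ = bounded x

sum-const : ∀ n x → sum {n} (λ _ → x) ≡ n * x
sum-const zero x = refl
sum-const (suc n) x = cong (x +_) (sum-const n x)

term≤sum : (f : Fin n → ℕ) (i : Fin n) → f i ≤ sum f
term≤sum f zero = m≤m+n _ _
term≤sum f (suc i) = ≤-trans (term≤sum (f ∘ suc) i) (m≤n+m _ (f zero))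

sum>0⇒term>0 : (f : Fin n → ℕ) → 0 < sum f → ∃ λ i → 0 < f i
sum>0⇒term>0 {n = suc n} f pos with f zero in eq
... | suc _ = zero , subst (0 <_) (sym eq) (s≤s z≤n)
... | zero with sum>0⇒term>0 (f ∘ suc) pos
...   | i , fi>0 = suc i , fi>0

sum-point : (i : Fin n) → sum (λ x → indicator (i Fin.≟ x)) ≡ 1
sum-point i = trans (sum-cong-≗ (λ x → sym (*-identityʳ (indicator (i Fin.≟ x))))) (sum-pick i (λ _ → 1))

sum-≤-≡⇒≡ : (f g : Fin n → ℕ) → (∀ i → f i ≤ g i) → sum f ≡ sum g → ∀ i → f i ≡ g i
sum-≤-≡⇒≡ {n = suc n} f g f≤g eq = λ
  { zero → head≡
  ; (suc i) → sum-≤-≡⇒≡ (f ∘ suc) (g ∘ suc) (f≤g ∘ suc)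
                (+-cancelˡ-≡ (f zero) _ _ (trans eq (cong (_+ sum (g ∘ suc)) (sym head≡)))) i }
  where
  head≡ : f zero ≡ g zero
  head≡ = ≤-antisym (f≤g zero) (+-cancelʳ-≤ (sum (f ∘ suc)) _ _
    (≤-trans (+-monoʳ-≤ (g zero) (sum-mono-≤ (f≤g ∘ suc))) (≤-reflexive (sym eq))))

sum-indicator-≤ : {A : Fin n → Set} (A? : ∀ i → Dec (A i)) (h : ∀ i → A i → Fin c) →
  (∀ i j (a : A i) (b : A j) → h i a ≡ h j b → i ≡ j) → sum (indicator ∘ A?) ≤ c
sum-indicator-≤ {n = zero} A? h inj = z≤n
sum-indicator-≤ {n = suc n} A? h inj with A? zero
... | no _ = sum-indicator-≤ (A? ∘ suc) (h ∘ suc) λ i j a b eq → Fin.suc-injective (inj _ _ a b eq)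
sum-indicator-≤ {n = suc n} {c = zero} A? h inj | yes a with () ← h zero a
sum-indicator-≤ {n = suc n} {c = suc c} {A = A} A? h inj | yes a =
  s≤s (sum-indicator-≤ (A? ∘ suc) (λ i b → punchOut (distinct i b))
    λ i j b b′ eq → Fin.suc-injective (inj _ _ b b′ (Fin.punchOut-injective (distinct i b) (distinct j b′) eq)))
  where
  distinct : ∀ i (b : A (suc i)) → h zero a ≢ h (suc i) b
  distinct i b eq with () ← inj _ _ a b eq

sum-indicator-unique : {A : Fin n → Set} (A? : ∀ i → Dec (A i)) → sum (indicator ∘ A?) ≤ 1 →
  ∀ i j → A i → A j → i ≡ j
sum-indicator-unique A? ≤1 zero zero a b = refl
sum-indicator-unique A? ≤1 zero (suc j) a b = contradiction ≤1 (<⇒≱ (begin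
  2 ≡⟨ cong₂ _+_ (sym (indicator-yes (A? zero) a)) (sym (indicator-yes (A? (suc j)) b)) ⟩
  indicator (A? zero) + indicator (A? (suc j)) ≤⟨ +-monoʳ-≤ (indicator (A? zero)) (term≤sum (indicator ∘ A? ∘ suc) j) ⟩
  sum (indicator ∘ A?) ∎))
  where open ≤-Reasoning
sum-indicator-unique A? ≤1 (suc i) zero a b = sym (sum-indicator-unique A? ≤1 zero (suc i) b a)
sum-indicator-unique A? ≤1 (suc i) (suc j) a b =
  cong suc (sum-indicator-unique (A? ∘ suc) (≤-trans (m≤n+m _ (indicator (A? zero))) ≤1) i j a b)

-- Column zero absorbs the slack of the rows.
roundWithSlack : ∀ t (w : Fin t → Fin c → ℕ) d .{{_ : NonZero d}} (b : Fin c → ℕ) →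
  (∀ j → sum (w j) ≤ d) → (∀ p → sum (λ j → w j p) ≡ d * b p) →
  ∃ λ (f : Fin t → Fin (suc c)) → (∀ j p → f j ≡ suc p → 0 < w j p) ×
    (∀ j → f j ≡ zero → sum (w j) < d) × (∀ p → count f (suc p) ≡ b p)
roundWithSlack {c} t w d b row column
  = let f , pos , bounded = round t w⁺ d b⁺ (λ j → m∸n+n≡m (row j)) (≤-reflexive ∘ column⁺) in
    f , (λ j p eq → subst (λ y → 0 < w⁺ j y) eq (pos j))
      , (λ j eq → m∸n≢0⇒n<m (m<n⇒n≢0 (subst (λ y → 0 < w⁺ j y) eq (pos j))))
      -- The capacities `b⁺` add up to the number t of rows, so every upper bound given by `round`
      -- is attained.
      , (λ p → sum-≤-≡⇒≡ (count f) b⁺ bounded (trans (sum-count f) (sym total)) (suc p))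
  where
  w⁺ : Fin t → Fin (suc c) → ℕ
  w⁺ j zero = d ∸ sum (w j)
  w⁺ j (suc p) = w j p
  b⁺ : Fin (suc c) → ℕ
  b⁺ zero = t ∸ sum b
  b⁺ (suc p) = b p
  sum-count : ∀ {c} (f : Fin t → Fin c) → sum (count f) ≡ t
  sum-count {c} f = begin
    sum (λ p → sum (λ j → indicator (f j Fin.≟ p))) ≡⟨ ∑-comm (λ p j → indicator (f j Fin.≟ p)) ⟩
    sum (λ j → sum (λ p → indicator (f j Fin.≟ p)))
      ≡⟨ sum-cong-≗ (λ j → sum-point (f j)) ⟩
    sum {t} (λ _ → 1) ≡⟨ trans (sum-const t 1) (*-identityʳ t) ⟩
    t ∎
    where open ≡-Reasoning
  weights : d * sum b ≡ sum (λ j → sum (w j))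
  weights = begin
    d * sum b ≡⟨ *-distribˡ-sum d b ⟩
    sum (λ p → d * b p) ≡⟨ sum-cong-≗ column ⟨
    sum (λ p → sum (λ j → w j p)) ≡⟨ ∑-comm (λ p j → w j p) ⟩
    sum (λ j → sum (w j)) ∎
    where open ≡-Reasoning
  sum-d : sum {t} (λ _ → d) ≡ d * t
  sum-d = trans (sum-const t d) (*-comm t d)
  sum-b≤t : sum b ≤ t
  sum-b≤t = *-cancelˡ-≤ d (begin
    d * sum b ≡⟨ weights ⟩
    sum (λ j → sum (w j)) ≤⟨ sum-mono-≤ row ⟩
    sum {t} (λ _ → d) ≡⟨ sum-d ⟩
    d * t ∎)
    where open ≤-Reasoning
  total : sum b⁺ ≡ t
  total = m∸n+n≡m sum-b≤t
  column⁺ : ∀ p → sum (λ j → w⁺ j p) ≡ d * b⁺ p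
  column⁺ (suc p) = column p
  column⁺ zero = +-cancelʳ-≡ (d * sum b) _ _ (begin
    sum (λ j → d ∸ sum (w j)) + d * sum b ≡⟨ cong (sum (λ j → d ∸ sum (w j)) +_) weights ⟩
    sum (λ j → d ∸ sum (w j)) + sum (λ j → sum (w j)) ≡⟨ ∑-distrib-+ (λ j → d ∸ sum (w j)) _ ⟨
    sum (λ j → d ∸ sum (w j) + sum (w j)) ≡⟨ sum-cong-≗ (λ j → m∸n+n≡m (row j)) ⟩
    sum {t} (λ _ → d) ≡⟨ sum-d ⟩
    d * t ≡⟨ cong (d *_) total ⟨
    d * (t ∸ sum b + sum b) ≡⟨ *-distribˡ-+ d (t ∸ sum b) (sum b) ⟩
    d * (t ∸ sum b) + d * sum b ∎)
    where open ≡-Reasoning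

-- Baranyai's theorem

-- Numbers the subsets so that traces can serve as columns of a rounding problem.
encode : Subset n → Fin (2 ^ n)
encode [] = zero
encode (outside ∷ S) = combine {2} zero (encode S)
encode (inside ∷ S) = combine {2} (suc zero) (encode S)

decode : ∀ n → Fin (2 ^ n) → Subset n
decode zero _ = []
decode (suc n) x with remQuot {2} (2 ^ n) x
... | zero , y = outside ∷ decode n y
... | suc zero , y = inside ∷ decode n y

decode-encode : (S : Subset n) → decode n (encode S) ≡ S
decode-encode [] = refl
decode-encode {n = suc n} (outside ∷ S)
  rewrite Fin.remQuot-combine {2} zero (encode S) = cong (outside ∷_) (decode-encode S)
decode-encode {n = suc n} (inside ∷ S)
  rewrite Fin.remQuot-combine {2} (suc zero) (encode S) = cong (inside ∷_) (decode-encode S)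

encode-decode : ∀ n x → encode (decode n x) ≡ x
encode-decode zero zero = refl
encode-decode (suc n) x with remQuot {2} (2 ^ n) x in eq
... | zero , y = trans (cong (combine {2} zero) (encode-decode n y))
  (trans (cong (λ z → combine {2} (proj₁ z) (proj₂ z)) (sym eq)) (Fin.combine-remQuot {2} (2 ^ n) x))
... | suc zero , y = trans (cong (combine {2} (suc zero)) (encode-decode n y))
  (trans (cong (λ z → combine {2} (proj₁ z) (proj₂ z)) (sym eq)) (Fin.combine-remQuot {2} (2 ^ n) x))

encode-injective : {S S′ : Subset n} → encode S ≡ encode S′ → S ≡ S′
encode-injective {S = S} {S′} eq = trans (sym (decode-encode S)) (trans (cong (decode _) eq) (decode-encode S′))

_≟ˢ_ : (S S′ : Subset n) → Dec (S ≡ S′)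
_≟ˢ_ = Vec.≡-dec Bool._≟_

absorption : ∀ n k → suc k * (suc n C suc k) ≡ suc n * (n C k)
absorption zero zero = refl
absorption zero (suc k) = *-zeroʳ (2 + k)
absorption (suc n) zero = trans (*-identityˡ _) (trans (nC1≡n (2 + n)) (sym (*-identityʳ _)))
absorption (suc n) (suc k) = begin
  (2 + k) * ((2 + n) C (2 + k)) ≡⟨ cong ((2 + k) *_) (nCk+nC[k+1]≡[n+1]C[k+1] (suc n) (suc k)) ⟨
  (2 + k) * ((suc n C suc k) + (suc n C (2 + k))) ≡⟨ *-distribˡ-+ (2 + k) (suc n C suc k) _ ⟩
  (suc n C suc k) + suc k * (suc n C suc k) + (2 + k) * (suc n C (2 + k))
    ≡⟨ cong₂ (λ x y → (suc n C suc k) + x + y) (absorption n k) (absorption n (suc k)) ⟩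
  (suc n C suc k) + suc n * (n C k) + suc n * (n C suc k) ≡⟨ +-assoc (suc n C suc k) _ _ ⟩
  (suc n C suc k) + (suc n * (n C k) + suc n * (n C suc k))
    ≡⟨ cong ((suc n C suc k) +_) (*-distribˡ-+ (suc n) (n C k) (n C suc k)) ⟨
  (suc n C suc k) + suc n * ((n C k) + (n C suc k))
    ≡⟨ cong (λ x → (suc n C suc k) + suc n * x) (nCk+nC[k+1]≡[n+1]C[k+1] n k) ⟩
  (2 + n) * (suc n C suc k) ∎
  where open ≡-Reasoning

-- The number of d-subsets of an (m + 1)-set that contain a given point.
through : ℕ → ℕ → ℕ
through m zero = 0
through m (suc d) = m C d

through-pascal : ∀ m d → through m d + (m C d) ≡ suc m C d
through-pascal m zero = refl
through-pascal m (suc d) = nCk+nC[k+1]≡[n+1]C[k+1] m d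

-- If each of the C(m+1,d) copies of a trace receives the next point with weight d / (m+1), the
-- total is an integer. This makes the column sums of the rounding exact.
through-absorption : ∀ m d → (suc m C d) * d ≡ suc m * through m d
through-absorption m zero = trans (*-zeroʳ (suc m C 0)) (sym (*-zeroʳ (suc m)))
through-absorption m (suc d) = trans (*-comm (suc m C suc d) (suc d)) (absorption m d)

module Distribute {T t k : ℕ} (class : Fin T → Fin t) where

  -- The traces of the blocks on the first ℓ points, with m points to go.
  record Stage (ℓ m : ℕ) : Set where
    field
      block        : Fin T → Subset ℓ
      size         : ∀ i → ∣ block i ∣ ≤ k
      multiplicity : ∀ S d → ∣ S ∣ + d ≡ k → sum (λ i → indicator (block i ≟ˢ S)) ≡ m C d
      -- Blocks of one class must stay disjoint, so each coming point serves at most one of them and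
      -- their joint demand is at most m.
      room         : ∀ j → sum (λ i → indicator (class i Fin.≟ j) * (k ∸ ∣ block i ∣)) ≤ m
      disjoint     : ∀ i i′ → class i ≡ class i′ → i ≢ i′ → ∀ x → x ∈ block i → x ∉ block i′

  module Step {ℓ m : ℕ} (stage : Stage ℓ (suc m)) where
    open Stage stage

    need : Fin T → ℕ
    need i = k ∸ ∣ block i ∣

    -- Columns are traces rather than single blocks, because it is the number of extended copies of
    -- each trace that has to come out exactly.
    weight : Fin t → Fin (2 ^ ℓ) → ℕ
    weight j x = sum λ i → indicator (class i Fin.≟ j) * (indicator (encode (block i) Fin.≟ x) * need i)

    quota : Fin (2 ^ ℓ) → ℕ
    quota x = through m (k ∸ ∣ decode ℓ x ∣)

    row : ∀ j → sum (weight j) ≡ sum (λ i → indicator (class i Fin.≟ j) * need i)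
    row j = begin
      sum (weight j) ≡⟨ ∑-comm (λ x i → indicator (class i Fin.≟ j) * (indicator (encode (block i) Fin.≟ x) * need i)) ⟩
      sum (λ i → sum λ x → indicator (class i Fin.≟ j) * (indicator (encode (block i) Fin.≟ x) * need i))
        ≡⟨ sum-cong-≗ (λ i → *-distribˡ-sum (indicator (class i Fin.≟ j)) (λ x → indicator (encode (block i) Fin.≟ x) * need i)) ⟨
      sum (λ i → indicator (class i Fin.≟ j) * sum λ x → indicator (encode (block i) Fin.≟ x) * need i)
        ≡⟨ sum-cong-≗ (λ i → cong (indicator (class i Fin.≟ j) *_) (sum-pick (encode (block i)) (λ _ → need i))) ⟩
      sum (λ i → indicator (class i Fin.≟ j) * need i) ∎
      where open ≡-Reasoning

    indicator-encode : ∀ i S → indicator (encode (block i) Fin.≟ encode S) ≡ indicator (block i ≟ˢ S)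
    indicator-encode i S = ≤-antisym
      (indicator-≤ (encode (block i) Fin.≟ encode S) (block i ≟ˢ S) encode-injective)
      (indicator-≤ (block i ≟ˢ S) (encode (block i) Fin.≟ encode S) (cong encode))

    column : ∀ S → sum (λ j → weight j (encode S)) ≡ suc m * through m (k ∸ ∣ S ∣)
    column S = begin
      sum (λ j → weight j (encode S))
        ≡⟨ ∑-comm (λ j i → indicator (class i Fin.≟ j) * (indicator (encode (block i) Fin.≟ encode S) * need i)) ⟩
      sum (λ i → sum λ j → indicator (class i Fin.≟ j) * (indicator (encode (block i) Fin.≟ encode S) * need i))
        ≡⟨ sum-cong-≗ (λ i → sum-pick (class i) (λ _ → indicator (encode (block i) Fin.≟ encode S) * need i)) ⟩
      sum (λ i → indicator (encode (block i) Fin.≟ encode S) * need i) ≡⟨ sum-cong-≗ same ⟩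
      sum (λ i → indicator (block i ≟ˢ S) * (k ∸ ∣ S ∣)) ≡⟨ *-distribʳ-sum (k ∸ ∣ S ∣) (λ i → indicator (block i ≟ˢ S)) ⟨
      sum (λ i → indicator (block i ≟ˢ S)) * (k ∸ ∣ S ∣) ≡⟨ total ⟩
      suc m * through m (k ∸ ∣ S ∣) ∎
      where
      open ≡-Reasoning
      same : ∀ i → indicator (encode (block i) Fin.≟ encode S) * need i ≡ indicator (block i ≟ˢ S) * (k ∸ ∣ S ∣)
      same i rewrite indicator-encode i S with block i ≟ˢ S
      ... | no _ = refl
      ... | yes refl = refl
      total : sum (λ i → indicator (block i ≟ˢ S)) * (k ∸ ∣ S ∣) ≡ suc m * through m (k ∸ ∣ S ∣)
      total with ∣ S ∣ ≤? k
      ... | yes S≤k = trans (cong (_* (k ∸ ∣ S ∣)) (multiplicity S _ (m+[n∸m]≡n S≤k))) (through-absorption m (k ∸ ∣ S ∣))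
      ... | no S≰k rewrite m≤n⇒m∸n≡0 (<⇒≤ (≰⇒> S≰k)) = trans (*-zeroʳ (sum (λ i → indicator (block i ≟ˢ S)))) (sym (*-zeroʳ (suc m)))

    column-quota : ∀ x → sum (λ j → weight j x) ≡ suc m * quota x
    column-quota x = subst (λ y → sum (λ j → weight j y) ≡ suc m * quota x) (encode-decode ℓ x) (column (decode ℓ x))

    assignment : ∃ λ (f : Fin t → Fin (suc (2 ^ ℓ))) → (∀ j p → f j ≡ suc p → 0 < weight j p) ×
      (∀ j → f j ≡ zero → sum (weight j) < suc m) × (∀ p → count f (suc p) ≡ quota p)
    assignment = roundWithSlack t weight (suc m) quota (λ j → ≤-trans (≤-reflexive (row j)) (room j)) column-quota

    f : Fin t → Fin (suc (2 ^ ℓ))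
    f = proj₁ assignment

    data Choice (j : Fin t) : Set where
      skip : f j ≡ zero → Choice j
      take : ∀ i → class i ≡ j → f j ≡ suc (encode (block i)) → 0 < need i → Choice j

    -- `f` names only a trace. Its positive weight yields a block of class j that has this trace and
    -- still needs a point.
    choose : ∀ j → Choice j
    choose j with f j in eq
    ... | zero = skip eq
    ... | suc x with sum>0⇒term>0 _ (proj₁ (proj₂ assignment) j x eq)
    ...   | i , pos with class i Fin.≟ j | encode (block i) Fin.≟ x
    ...     | yes c | yes refl = take i c eq (subst (0 <_) (trans (*-identityˡ _) (*-identityˡ _)) pos)

    added : ∀ {j} → Choice j → Fin T → Bool
    added (skip _) i = false
    added (take i′ _ _ _) i = does (i′ Fin.≟ i)

    extended : Fin T → Bool
    extended i = added (choose (class i)) i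

    block⁺ : Fin T → Subset (suc ℓ)
    block⁺ i = extended i ∷ block i

    bit : Bool → ℕ
    bit b = if b then 1 else 0

    extended-unique : ∀ {j} (ch : Choice j) i i′ → added ch i ≡ true → added ch i′ ≡ true → i ≡ i′
    extended-unique (take i₀ _ _ _) i i′ e e′ with i₀ Fin.≟ i | i₀ Fin.≟ i′
    ... | yes p | yes q = trans (sym p) q

    need⁺ : ∀ {j} (ch : Choice j) i → k ∸ ∣ added ch i ∷ block i ∣ + bit (added ch i) ≡ need i
    need⁺ (skip _) i = +-identityʳ _
    need⁺ (take i₀ _ _ pos) i with i₀ Fin.≟ i
    ... | no _ = +-identityʳ _
    ... | yes refl = trans (cong (_+ 1) (sym (pred[m∸n]≡m∸[1+n] k ∣ block i ∣)))
      (trans (+-comm _ 1) (suc-pred (need i) {{>-nonZero pos}}))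

    size⁺ : ∀ {j} (ch : Choice j) i → ∣ added ch i ∷ block i ∣ ≤ k
    size⁺ (skip _) i = size i
    size⁺ (take i₀ _ _ pos) i with i₀ Fin.≟ i
    ... | no _ = size i
    ... | yes refl = m∸n≢0⇒n<m (m<n⇒n≢0 pos)

    added-class : ∀ {j} (ch : Choice j) i → class i ≢ j → added ch i ≡ false
    added-class (skip _) i _ = refl
    added-class (take i₀ c _ _) i c≢ with i₀ Fin.≟ i
    ... | no _ = refl
    ... | yes refl = contradiction c c≢

    added-multiplicity : ∀ {j} (ch : Choice j) S →
      sum (λ i → indicator ((added ch i ∷ block i) ≟ˢ (inside ∷ S))) ≡ indicator (f j Fin.≟ suc (encode S))
    added-multiplicity (skip e) S rewrite e = sum-zero {n = T} (λ _ → refl)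
    added-multiplicity {j} (take i₀ c e _) S = begin
      sum (λ i → indicator ((does (i₀ Fin.≟ i) ∷ block i) ≟ˢ (inside ∷ S))) ≡⟨ sum-cong-≗ same ⟩
      sum (λ i → indicator (i₀ Fin.≟ i) * indicator (block i ≟ˢ S)) ≡⟨ sum-pick i₀ (λ i → indicator (block i ≟ˢ S)) ⟩
      indicator (block i₀ ≟ˢ S) ≡⟨ ≤-antisym
        (indicator-≤ (block i₀ ≟ˢ S) (f j Fin.≟ suc (encode S)) λ { refl → e })
        (indicator-≤ (f j Fin.≟ suc (encode S)) (block i₀ ≟ˢ S)
          λ e′ → encode-injective (Fin.suc-injective (trans (sym e) e′))) ⟩
      indicator (f j Fin.≟ suc (encode S)) ∎
      where
      open ≡-Reasoning
      same : ∀ i → indicator ((does (i₀ Fin.≟ i) ∷ block i) ≟ˢ (inside ∷ S)) ≡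
        indicator (i₀ Fin.≟ i) * indicator (block i ≟ˢ S)
      same i with i₀ Fin.≟ i
      ... | no _ = refl
      ... | yes _ = sym (*-identityˡ _)

    -- A class extends only its chosen block, so the extended copies of S correspond to the classes
    -- that `f` sends to S, and the rounding makes their number equal to the quota.
    extended-multiplicity : ∀ S → sum (λ i → indicator (block⁺ i ≟ˢ (inside ∷ S))) ≡ through m (k ∸ ∣ S ∣)
    extended-multiplicity S = begin
      sum (λ i → indicator (block⁺ i ≟ˢ (inside ∷ S)))
        ≡⟨ sum-cong-≗ (λ i → sum-pick (class i) (λ _ → indicator (block⁺ i ≟ˢ (inside ∷ S)))) ⟨
      sum (λ i → sum λ j → indicator (class i Fin.≟ j) * indicator (block⁺ i ≟ˢ (inside ∷ S)))
        ≡⟨ ∑-comm (λ i j → indicator (class i Fin.≟ j) * indicator (block⁺ i ≟ˢ (inside ∷ S))) ⟩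
      sum (λ j → sum λ i → indicator (class i Fin.≟ j) * indicator (block⁺ i ≟ˢ (inside ∷ S)))
        ≡⟨ sum-cong-≗ (λ j → sum-cong-≗ (own j)) ⟩
      sum (λ j → sum λ i → indicator ((added (choose j) i ∷ block i) ≟ˢ (inside ∷ S)))
        ≡⟨ sum-cong-≗ (λ j → added-multiplicity (choose j) S) ⟩
      count f (suc (encode S)) ≡⟨ proj₂ (proj₂ (proj₂ assignment)) (encode S) ⟩
      quota (encode S) ≡⟨ cong (λ X → through m (k ∸ ∣ X ∣)) (decode-encode S) ⟩
      through m (k ∸ ∣ S ∣) ∎
      where
      open ≡-Reasoning
      own : ∀ j i → indicator (class i Fin.≟ j) * indicator (block⁺ i ≟ˢ (inside ∷ S)) ≡
        indicator ((added (choose j) i ∷ block i) ≟ˢ (inside ∷ S))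
      own j i with class i Fin.≟ j
      ... | yes refl = *-identityˡ _
      ... | no c≢ rewrite added-class (choose j) i c≢ = refl

    split-multiplicity : ∀ S → sum (λ i → indicator (block⁺ i ≟ˢ (inside ∷ S))) +
      sum (λ i → indicator (block⁺ i ≟ˢ (outside ∷ S))) ≡ sum (λ i → indicator (block i ≟ˢ S))
    split-multiplicity S = trans (sym (∑-distrib-+ (λ i → indicator (block⁺ i ≟ˢ (inside ∷ S))) _)) (sum-cong-≗ split)
      where
      split : ∀ i → indicator (block⁺ i ≟ˢ (inside ∷ S)) + indicator (block⁺ i ≟ˢ (outside ∷ S)) ≡ indicator (block i ≟ˢ S)
      split i with extended i
      ... | true = +-identityʳ _
      ... | false = refl

    -- Pascal's rule: of the C(m+1,d) copies of a trace, C(m,d-1) receive the new point and C(m,d)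
    -- do not.
    multiplicity⁺ : ∀ S d → ∣ S ∣ + d ≡ k → sum (λ i → indicator (block⁺ i ≟ˢ S)) ≡ m C d
    multiplicity⁺ (inside ∷ S) d eq = trans (extended-multiplicity S)
      (cong (through m) (trans (cong (_∸ ∣ S ∣) (sym (trans (+-suc ∣ S ∣ d) eq))) (m+n∸m≡n ∣ S ∣ (suc d))))
    multiplicity⁺ (outside ∷ S) d eq = +-cancelˡ-≡ (through m d) _ _ (begin
      through m d + sum (λ i → indicator (block⁺ i ≟ˢ (outside ∷ S)))
        ≡⟨ cong (λ x → through m x + sum (λ i → indicator (block⁺ i ≟ˢ (outside ∷ S))))
             (trans (cong (_∸ ∣ S ∣) (sym eq)) (m+n∸m≡n ∣ S ∣ d)) ⟨
      through m (k ∸ ∣ S ∣) + sum (λ i → indicator (block⁺ i ≟ˢ (outside ∷ S)))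
        ≡⟨ cong (_+ sum (λ i → indicator (block⁺ i ≟ˢ (outside ∷ S)))) (extended-multiplicity S) ⟨
      sum (λ i → indicator (block⁺ i ≟ˢ (inside ∷ S))) + sum (λ i → indicator (block⁺ i ≟ˢ (outside ∷ S)))
        ≡⟨ split-multiplicity S ⟩
      sum (λ i → indicator (block i ≟ˢ S)) ≡⟨ multiplicity S d eq ⟩
      suc m C d ≡⟨ through-pascal m d ⟨
      through m d + (m C d) ∎)
      where open ≡-Reasoning

    -- The bound has to drop by one. A class that extends a block loses one unit of demand; a class
    -- that skips the point had spare room by the strict inequality in `roundWithSlack`.
    room⁺ : ∀ j → sum (λ i → indicator (class i Fin.≟ j) * (k ∸ ∣ block⁺ i ∣)) ≤ m
    room⁺ j = s≤s⁻¹ (bound (choose j) refl)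
      where
      open ≤-Reasoning
      left : Fin T → ℕ
      left i = indicator (class i Fin.≟ j) * (k ∸ ∣ block⁺ i ∣)
      gain : Fin T → ℕ
      gain i = indicator (class i Fin.≟ j) * bit (extended i)
      total : sum left + sum gain ≡ sum (weight j)
      total = trans (sym (∑-distrib-+ left gain)) (trans (sum-cong-≗ λ i →
        trans (sym (*-distribˡ-+ (indicator (class i Fin.≟ j)) (k ∸ ∣ block⁺ i ∣) _))
              (cong (indicator (class i Fin.≟ j) *_) (need⁺ (choose (class i)) i))) (sym (row j)))
      bound : (ch : Choice j) → choose j ≡ ch → suc (sum left) ≤ suc m
      bound (skip e) _ = begin
        suc (sum left) ≤⟨ s≤s (m≤m+n _ (sum gain)) ⟩
        suc (sum left + sum gain) ≡⟨ cong suc total ⟩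
        suc (sum (weight j)) ≤⟨ proj₁ (proj₂ (proj₂ assignment)) j e ⟩
        suc m ∎
      bound (take i₀ refl _ _) eq = begin
        suc (sum left) ≡⟨ +-comm 1 (sum left) ⟩
        sum left + 1 ≡⟨ cong (sum left +_) one ⟨
        sum left + gain i₀ ≤⟨ +-monoʳ-≤ (sum left) (term≤sum gain i₀) ⟩
        sum left + sum gain ≡⟨ total ⟩
        sum (weight j) ≡⟨ row j ⟩
        sum (λ i → indicator (class i Fin.≟ j) * need i) ≤⟨ room j ⟩
        suc m ∎
        where
        one : gain i₀ ≡ 1
        one rewrite eq | indicator-yes (class i₀ Fin.≟ class i₀) refl = cong (_+ 0) (indicator-yes (i₀ Fin.≟ i₀) refl)

    disjoint⁺ : ∀ i i′ → class i ≡ class i′ → i ≢ i′ → ∀ x → x ∈ block⁺ i → x ∉ block⁺ i′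
    disjoint⁺ i i′ c i≢i′ (suc x) (there x∈) (there x∈′) = disjoint i i′ c i≢i′ x x∈ x∈′
    disjoint⁺ i i′ c i≢i′ zero x∈ x∈′ = i≢i′ (extended-unique (choose (class i)) i i′ (head∈ x∈)
        (trans (cong (λ j → added (choose j) i′) c) (head∈ x∈′)))
      where
      head∈ : ∀ {b} {S : Subset ℓ} → zero ∈ b ∷ S → b ≡ true
      head∈ here = refl

    next : Stage (suc ℓ) m
    next = record
      { block = block⁺
      ; size = λ i → size⁺ (choose (class i)) i
      ; multiplicity = multiplicity⁺
      ; room = room⁺
      ; disjoint = disjoint⁺
      }

  module _ (n : ℕ) (T≡ : T ≡ n C k) (fits : ∀ j → count class j * k ≤ n) where

    stage : ∀ ℓ m → ℓ + m ≡ n → Stage ℓ m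
    stage zero m refl = record
      { block = λ _ → []
      ; size = λ _ → z≤n
      ; multiplicity = λ { [] d refl → trans (sum-const T 1) (trans (*-identityʳ T) T≡) }
      ; room = λ j → ≤-trans (≤-reflexive (sym (*-distribʳ-sum k (λ i → indicator (class i Fin.≟ j))))) (fits j)
      ; disjoint = λ _ _ _ _ ()
      }
    stage (suc ℓ) m eq = Step.next (stage ℓ (suc m) (trans (+-suc ℓ m) eq))

    final : Stage n 0
    final = stage n 0 (+-identityʳ n)

-- Block i belongs to class i / c, so all classes but possibly the last have c blocks.
record Decomposition (n k c : ℕ) .{{_ : NonZero c}} : Set where
  field
    block      : Fin (n C k) → Subset n
    size       : ∀ i → ∣ block i ∣ ≡ k
    injective  : ∀ {i i′} → block i ≡ block i′ → i ≡ i′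
    surjective : ∀ S → ∣ S ∣ ≡ k → ∃ λ i → block i ≡ S
    disjoint   : ∀ i i′ → toℕ i / c ≡ toℕ i′ / c → i ≢ i′ → ∀ x → x ∈ block i → x ∉ block i′

-- Baranyai's theorem for classes of c blocks. Each set S on the first ℓ points
-- is a trace exactly C(n - ℓ, k - |S|) times; the fractional extension giving
-- the next point to a trace with weight (k - |S|) / (n - ℓ) is rounded.
abstract
  baranyai : ∀ n k c .{{_ : NonZero c}} → c * k ≤ n → Decomposition n k c
  baranyai n k c ck≤n = record
    { block = block
    ; size = size≡
    ; injective = λ {i} {i′} eq → sum-indicator-unique (λ x → block x ≟ˢ block i′)
        (≤-reflexive (once (block i′) (size≡ i′))) i i′ eq refl
    ; surjective = λ S S≡k → found S (sum>0⇒term>0 (λ i → indicator (block i ≟ˢ S)) (subst (0 <_) (sym (once S S≡k)) (s≤s z≤n)))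
    ; disjoint = λ i i′ eq → disjoint i i′ (Fin.fromℕ<-cong _ _ eq _ _)
    }
    where
    -- Indexing the classes by `Fin (n C k)` avoids a quotient rounded up; trailing classes may be
    -- empty.
    class : Fin (n C k) → Fin (n C k)
    class i = fromℕ< (≤-<-trans (m/n≤m (toℕ i) c) (Fin.toℕ<n i))
    class-toℕ : ∀ i → toℕ (class i) ≡ toℕ i / c
    class-toℕ i = Fin.toℕ-fromℕ< _
    fits : ∀ j → count class j * k ≤ n
    fits j = ≤-trans (*-monoˡ-≤ k (sum-indicator-≤ (λ i → class i Fin.≟ j) (λ i _ → fromℕ< (m%n<n (toℕ i) c)) inj)) ck≤n
      where
      inj : ∀ i i′ → class i ≡ j → class i′ ≡ j → fromℕ< (m%n<n (toℕ i) c) ≡ fromℕ< (m%n<n (toℕ i′) c) → i ≡ i′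
      inj i i′ p q eq = Fin.toℕ-injective (begin
        toℕ i ≡⟨ m≡m%n+[m/n]*n (toℕ i) c ⟩
        toℕ i % c + toℕ i / c * c ≡⟨ cong₂ (λ x y → x + y * c) (Fin.fromℕ<-injective _ _ _ _ eq)
          (trans (sym (class-toℕ i)) (trans (cong toℕ (trans p (sym q))) (class-toℕ i′))) ⟩
        toℕ i′ % c + toℕ i′ / c * c ≡⟨ m≡m%n+[m/n]*n (toℕ i′) c ⟨
        toℕ i′ ∎)
        where open ≡-Reasoning
    open Distribute.Stage (Distribute.final class n refl fits)
    full : ∀ i → k ≤ ∣ block i ∣
    full i = m∸n≡0⇒m≤n (n≤0⇒n≡0 (≤-trans (≤-reflexive (sym one)) (≤-trans (term≤sum _ i) (room (class i)))))
      where
      one : indicator (class i Fin.≟ class i) * (k ∸ ∣ block i ∣) ≡ k ∸ ∣ block i ∣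
      one rewrite indicator-yes (class i Fin.≟ class i) refl = *-identityˡ _
    size≡ : ∀ i → ∣ block i ∣ ≡ k
    size≡ i = ≤-antisym (size i) (full i)
    once : ∀ S → ∣ S ∣ ≡ k → sum (λ i → indicator (block i ≟ˢ S)) ≡ 1
    once S S≡k = multiplicity S 0 (trans (+-identityʳ _) S≡k)
    found : ∀ S → (∃ λ i → 0 < indicator (block i ≟ˢ S)) → ∃ λ i → block i ≡ S
    found S (i , pos) with block i ≟ˢ S
    ... | yes eq = i , eq

-- Colourings and minors of complements of Kneser graphs

colorable : ∀ {n k} q t .{{_ : NonZero q}} → q * k ≤ n → n C k ≤ t * q → Colorable (KneserComplement n k) t
colorable {n} {k} q t qk≤n C≤tq = color , proper
  where
  open Decomposition (baranyai n k q qk≤n)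
  G = KneserComplement n k
  index : V G → Fin (n C k)
  index (S , S≡k) = proj₁ (surjective S S≡k)
  block-index : ∀ v → block (index v) ≡ proj₁ v
  block-index (S , S≡k) = proj₂ (surjective S S≡k)
  color : V G → Fin t
  color v = fromℕ< (m<n*o⇒m/o<n (<-≤-trans (Fin.toℕ<n (index v)) C≤tq))
  proper : ∀ u v → Adj G u v → color u ≢ color v
  proper u v (u≢v , x , x∈) eq = disjoint (index u) (index v) (Fin.fromℕ<-injective _ _ _ _ eq)
      (λ i≡ → u≢v (trans (sym (block-index u)) (trans (cong block i≡) (block-index v))))
      x (subst (x ∈_) (sym (block-index u)) (proj₁ both)) (subst (x ∈_) (sym (block-index v)) (proj₂ both))
    where both = x∈p∩q⁻ (proj₁ u) (proj₁ v) x∈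

-- Complete minors from stars at two points

module _ {G : Graph} {P Q : V G → Set} where

  walk-map : (∀ {w} → P w → Q w) → ∀ {u v} → WalkIn G P u v → WalkIn G Q u v
  walk-map f here = here
  walk-map f (step a p w) = step a (f p) (walk-map f w)

module _ {G : Graph} {P : V G → Set} where

  walk-++ : ∀ {u v w} → WalkIn G P u v → WalkIn G P v w → WalkIn G P u w
  walk-++ here w = w
  walk-++ (step a p v) w = step a p (walk-++ v w)

  walk-reverse : (∀ {u v} → Adj G u v → Adj G v u) → ∀ {u v} → P u → WalkIn G P u v → WalkIn G P v u
  walk-reverse adj-sym Pu here = here
  walk-reverse adj-sym Pu (step a p w) = walk-++ (walk-reverse adj-sym p w) (step (adj-sym a) Pu here)

module _ {G : Graph} {t : ℕ} (D : Fin t → V G → Set) (D? : ∀ i v → Dec (D i v))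
         (disjoint : ∀ {i j v} → D i v → D j v → i ≡ j)
         (nonempty : ∀ i → ∃ (D i))
         (connected : ∀ i u v → D i u → D i v → WalkIn G (D i) u v)
         (adjacent : ∀ i j → i ≢ j → ∃ λ u → ∃ λ v → D i u × D j v × Adj G u v) where

  private
    locate : V G → Maybe (Fin t)
    locate v with Fin.any? (λ i → D? i v)
    ... | yes (i , _) = just i
    ... | no _ = nothing

    locate⁺ : ∀ {i v} → D i v → locate v ≡ just i
    locate⁺ {i} {v} d with Fin.any? (λ i → D? i v)
    ... | yes (j , d′) = cong just (disjoint d′ d)
    ... | no none = contradiction (i , d) none

    locate⁻ : ∀ {i v} → locate v ≡ just i → D i v
    locate⁻ {i} {v} eq with Fin.any? (λ i → D? i v)
    locate⁻ refl | yes (j , d) = d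

  completeMinor : CompleteMinor G t
  completeMinor = record
    { β = locate
    ; nonempty = λ i → let v , d = nonempty i in v , locate⁺ d
    ; connected = λ i u v p q → walk-map locate⁺ (connected i u v (locate⁻ p) (locate⁻ q))
    ; adjacent = λ i j i≢j → let u , v , d , d′ , a = adjacent i j i≢j in u , v , locate⁺ d , locate⁺ d′ , a
    }

-- The two leading coordinates are the points 0 and 1, and k = K + 1. `A j` lists the petals of
-- branch set j without the point 1, and `B j` its further k-sets, which avoid 0 and 1. `touches`
-- ties the latter to the petals. `covers` concerns the sets that contain 0 but not 1, with S what
-- remains of them; the sets through both points share 1 with every petal.
module _ {N K e s c : ℕ} (stars : Decomposition (suc N) K 1)
  (A : Fin e → Fin (suc s) → Subset N) (A-size : ∀ j b → ∣ A j b ∣ ≡ K)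
  (A-class : ∀ {j b j′ b′} → A j b ≡ A j′ b′ → j ≡ j′)
  (B : Fin e → Fin c → Subset N) (B-size : ∀ j a → ∣ B j a ∣ ≡ suc K)
  (B-class : ∀ {j a j′ a′} → B j a ≡ B j′ a′ → j ≡ j′)
  (touches : ∀ j a → ∃ λ b → Nonempty (B j a ∩ A j b))
  (covers : ∀ j S → ∣ S ∣ ≡ K → (∃ λ b → Nonempty (A j b ∩ S)) ⊎ (∃ λ a → Nonempty (B j a ∩ S)))
  where

  private
    G : Graph
    G = KneserComplement (2 + N) (suc K)

    module Star = Decomposition stars

    C₁ : ℕ
    C₁ = suc N C K

    star : Fin C₁ → V G
    star i = inside ∷ Star.block i , cong suc (Star.size i)

    petal : ∀ j b → V G
    petal j b = outside ∷ inside ∷ A j b , cong suc (A-size j b)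

    leaf : ∀ j a → V G
    leaf j a = outside ∷ outside ∷ B j a , B-size j a

    Member : Fin C₁ ⊎ Fin e → V G → Set
    Member (inj₁ i) v = proj₁ v ≡ proj₁ (star i)
    Member (inj₂ j) v = (∃ λ b → proj₁ v ≡ proj₁ (petal j b)) ⊎ (∃ λ a → proj₁ v ≡ proj₁ (leaf j a))

    member? : ∀ i v → Dec (Member i v)
    member? (inj₁ i) v = proj₁ v ≟ˢ _
    member? (inj₂ j) v = Fin.any? (λ b → proj₁ v ≟ˢ _) ⊎-dec Fin.any? (λ a → proj₁ v ≟ˢ _)

    tails : ∀ {n} {x y : _} {S S′ : Subset n} → x ∷ S ≡ y ∷ S′ → S ≡ S′
    tails = Vec.∷-injectiveʳ

    member-unique : ∀ i j {v} → Member i v → Member j v → i ≡ j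
    member-unique (inj₁ i) (inj₁ j) p q = cong inj₁ (Star.injective (tails (trans (sym p) q)))
    member-unique (inj₁ i) (inj₂ j) p (inj₁ (_ , q)) with () ← trans (sym p) q
    member-unique (inj₁ i) (inj₂ j) p (inj₂ (_ , q)) with () ← trans (sym p) q
    member-unique (inj₂ i) (inj₁ j) (inj₁ (_ , p)) q with () ← trans (sym p) q
    member-unique (inj₂ i) (inj₁ j) (inj₂ (_ , p)) q with () ← trans (sym p) q
    member-unique (inj₂ i) (inj₂ j) (inj₁ (_ , p)) (inj₁ (_ , q)) =
      cong inj₂ (A-class (tails (tails (trans (sym p) q))))
    member-unique (inj₂ i) (inj₂ j) (inj₂ (_ , p)) (inj₂ (_ , q)) =
      cong inj₂ (B-class (tails (tails (trans (sym p) q))))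
    member-unique (inj₂ i) (inj₂ j) (inj₁ (_ , p)) (inj₂ (_ , q)) with () ← trans (sym p) q
    member-unique (inj₂ i) (inj₂ j) (inj₂ (_ , p)) (inj₁ (_ , q)) with () ← trans (sym p) q

    member-nonempty : ∀ i → ∃ (Member i)
    member-nonempty (inj₁ i) = star i , refl
    member-nonempty (inj₂ j) = petal j zero , inj₁ (zero , refl)

    vertex-≡ : {u v : V G} → proj₁ u ≡ proj₁ v → u ≡ v
    vertex-≡ {_ , p} {_ , q} refl = cong (_ ,_) (≡-irrelevant p q)

    adj : ∀ u v {x} → proj₁ u ≢ proj₁ v → x ∈ proj₁ u → x ∈ proj₁ v → Adj G u v
    adj u v {x} u≢v p q = u≢v , x , x∈p∩q⁺ (p , q)

    adj-sym : ∀ {u v} → Adj G u v → Adj G v u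
    adj-sym {u} {v} (u≢v , x , x∈) = let p , q = x∈p∩q⁻ (proj₁ u) (proj₁ v) x∈ in adj v u (≢-sym u≢v) q p

    petals : ∀ {j b j′ b′} → A j b ≢ A j′ b′ → Adj G (petal j b) (petal j′ b′)
    petals {j} {b} {j′} {b′} A≢ = adj (petal j b) (petal j′ b′) (A≢ ∘ tails ∘ tails) (there here) (there here)

    module _ (j : Fin e) where

      petal-walk : ∀ b → WalkIn G (Member (inj₂ j)) (petal j b) (petal j zero)
      petal-walk b with A j b ≟ˢ A j zero
      ... | yes eq = subst (WalkIn G _ (petal j b)) (vertex-≡ (cong (λ S → outside ∷ inside ∷ S) eq)) here
      ... | no A≢ = step (petals A≢) (inj₁ (zero , refl)) here

      walk-to-hub : ∀ u → Member (inj₂ j) u → WalkIn G (Member (inj₂ j)) u (petal j zero)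
      walk-to-hub u (inj₁ (b , eq)) rewrite vertex-≡ {u} {petal j b} eq = petal-walk b
      walk-to-hub u (inj₂ (a , eq)) rewrite vertex-≡ {u} {leaf j a} eq with touches j a
      ... | b , x , x∈ = let p , q = x∈p∩q⁻ (B j a) (A j b) x∈ in
        step (adj (leaf j a) (petal j b) (λ ()) (there (there p)) (there (there q))) (inj₁ (b , refl)) (petal-walk b)

    member-connected : ∀ i u v → Member i u → Member i v → WalkIn G (Member i) u v
    member-connected (inj₁ i) u v p q = subst (WalkIn G _ u) (vertex-≡ (trans p (sym q))) here
    member-connected (inj₂ j) u v p q = walk-++ (walk-to-hub j u p)
      (walk-reverse (λ {u} {v} → adj-sym {u} {v}) q (walk-to-hub j v q))

    Linked : Fin C₁ ⊎ Fin e → Fin C₁ ⊎ Fin e → Set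
    Linked i j = ∃ λ u → ∃ λ v → Member i u × Member j v × Adj G u v

    star-linked : ∀ i j S → Star.block i ≡ S → Linked (inj₁ i) (inj₂ j)
    star-linked i j (inside ∷ S) eq = star i , petal j zero , refl , inj₁ (zero , refl) ,
      adj (star i) (petal j zero) (λ ()) (there (subst (zero ∈_) (sym eq) here)) (there here)
    star-linked i j (outside ∷ S) eq with covers j S (trans (cong ∣_∣ (sym eq)) (Star.size i))
    ... | inj₁ (b , x , x∈) = let p , q = x∈p∩q⁻ (A j b) S x∈ in
      star i , petal j b , refl , inj₁ (b , refl) ,
      adj (star i) (petal j b) (λ ()) (there (subst (suc x ∈_) (sym eq) (there q))) (there (there p))
    ... | inj₂ (a , x , x∈) = let p , q = x∈p∩q⁻ (B j a) S x∈ in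
      star i , leaf j a , refl , inj₂ (a , refl) ,
      adj (star i) (leaf j a) (λ ()) (there (subst (suc x ∈_) (sym eq) (there q))) (there (there p))

    member-linked : ∀ i j → i ≢ j → Linked i j
    member-linked (inj₁ i) (inj₁ j) i≢j = star i , star j , refl , refl ,
      adj (star i) (star j) (λ eq → i≢j (cong inj₁ (Star.injective (tails eq)))) here here
    member-linked (inj₁ i) (inj₂ j) _ = star-linked i j _ refl
    member-linked (inj₂ i) (inj₁ j) _ = let u , v , p , q , a = star-linked j i _ refl in v , u , q , p , adj-sym {u} {v} a
    member-linked (inj₂ i) (inj₂ j) i≢j = petal i zero , petal j zero , inj₁ (zero , refl) , inj₁ (zero , refl) ,
      petals (i≢j ∘ cong inj₂ ∘ A-class)

    splitAt-injective : ∀ {i j : Fin (C₁ + e)} → splitAt C₁ i ≡ splitAt C₁ j → i ≡ j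
    splitAt-injective {i} {j} eq =
      trans (sym (Fin.join-splitAt C₁ e i)) (trans (cong (join C₁ e) eq) (Fin.join-splitAt C₁ e j))

  twoStarMinor : CompleteMinor (KneserComplement (2 + N) (suc K)) ((suc N C K) + e)
  twoStarMinor = completeMinor (Member ∘ splitAt C₁) (member? ∘ splitAt C₁)
    (λ p q → splitAt-injective (member-unique _ _ p q))
    (member-nonempty ∘ splitAt C₁)
    (member-connected ∘ splitAt C₁)
    (λ i j i≢j → member-linked (splitAt C₁ i) (splitAt C₁ j) (i≢j ∘ splitAt-injective))

-- Unions of disjoint sets, and sets that avoid a given set

∣p∪q∣≡∣p∣+∣q∣ : (p q : Subset n) → ¬ Nonempty (p ∩ q) → ∣ p ∪ q ∣ ≡ ∣ p ∣ + ∣ q ∣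
∣p∪q∣≡∣p∣+∣q∣ [] [] _ = refl
∣p∪q∣≡∣p∣+∣q∣ (inside ∷ p) (inside ∷ q) apart = contradiction (zero , here) apart
∣p∪q∣≡∣p∣+∣q∣ (inside ∷ p) (outside ∷ q) apart = cong suc (∣p∪q∣≡∣p∣+∣q∣ p q λ (x , x∈) → apart (suc x , there x∈))
∣p∪q∣≡∣p∣+∣q∣ (outside ∷ p) (inside ∷ q) apart =
  trans (cong suc (∣p∪q∣≡∣p∣+∣q∣ p q λ (x , x∈) → apart (suc x , there x∈))) (sym (+-suc ∣ p ∣ ∣ q ∣))
∣p∪q∣≡∣p∣+∣q∣ (outside ∷ p) (outside ∷ q) apart = ∣p∪q∣≡∣p∣+∣q∣ p q λ (x , x∈) → apart (suc x , there x∈)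

⋃ : (Fin m → Subset n) → Subset n
⋃ {m = zero} F = ∅
⋃ {m = suc m} F = F zero ∪ ⋃ (F ∘ suc)

∈-⋃⁺ : (F : Fin m → Subset n) {x : Fin n} (i : Fin m) → x ∈ F i → x ∈ ⋃ F
∈-⋃⁺ F zero x∈ = x∈p∪q⁺ (inj₁ x∈)
∈-⋃⁺ F (suc i) x∈ = x∈p∪q⁺ (inj₂ (∈-⋃⁺ (F ∘ suc) i x∈))

∈-⋃⁻ : (F : Fin m → Subset n) {x : Fin n} → x ∈ ⋃ F → ∃ λ i → x ∈ F i
∈-⋃⁻ {m = zero} F x∈ = contradiction x∈ ∉⊥
∈-⋃⁻ {m = suc m} F x∈ with x∈p∪q⁻ (F zero) (⋃ (F ∘ suc)) x∈
... | inj₁ x∈₀ = zero , x∈₀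
... | inj₂ x∈⋃ = let i , x∈ᵢ = ∈-⋃⁻ (F ∘ suc) x∈⋃ in suc i , x∈ᵢ

Disjoint : (Fin m → Subset n) → Set
Disjoint F = ∀ i j → i ≢ j → ∀ x → x ∈ F i → x ∉ F j

∣⋃∣ : ∀ {k} (F : Fin m → Subset n) → (∀ i → ∣ F i ∣ ≡ k) → Disjoint F → ∣ ⋃ F ∣ ≡ m * k
∣⋃∣ {m = zero} {n = n} F size disj = ∣⊥∣≡0 n
∣⋃∣ {m = suc m} F size disj = trans
  (∣p∪q∣≡∣p∣+∣q∣ (F zero) (⋃ (F ∘ suc)) λ (x , x∈) →
    let p , q = x∈p∩q⁻ (F zero) _ x∈ ; i , r = ∈-⋃⁻ (F ∘ suc) q in disj zero (suc i) (λ ()) x p r)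
  (cong₂ _+_ (size zero) (∣⋃∣ (F ∘ suc) (size ∘ suc) λ i j i≢j → disj (suc i) (suc j) (i≢j ∘ Fin.suc-injective)))

⋃-meets : (F : Fin m → Subset n) (S : Subset n) → Nonempty (⋃ F ∩ S) → ∃ λ i → Nonempty (F i ∩ S)
⋃-meets F S (x , x∈) = let p , q = x∈p∩q⁻ (⋃ F) S x∈ ; i , r = ∈-⋃⁻ F p in i , x , x∈p∩q⁺ (r , q)

large-family-meets : ∀ {k} (F : Fin m → Subset n) → (∀ i → ∣ F i ∣ ≡ k) → Disjoint F →
  ∀ S → n < m * k + ∣ S ∣ → ∃ λ i → Nonempty (F i ∩ S)
large-family-meets {m = m} {n = n} {k = k} F size disj S large with nonempty? (⋃ F ∩ S)
... | yes meet = ⋃-meets F S meet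
... | no apart = contradiction large (≤⇒≯ (begin
  m * k + ∣ S ∣ ≡⟨ cong (_+ ∣ S ∣) (∣⋃∣ F size disj) ⟨
  ∣ ⋃ F ∣ + ∣ S ∣ ≡⟨ ∣p∪q∣≡∣p∣+∣q∣ (⋃ F) S apart ⟨
  ∣ ⋃ F ∪ S ∣ ≤⟨ ∣p∣≤n (⋃ F ∪ S) ⟩
  n ∎))
  where open ≤-Reasoning

-- Deletes the coordinates in W. On the sets that avoid W this preserves size and is injective,
-- which bounds their number by a binomial coefficient.
restrict : (W : Subset n) → Subset n → Subset ∣ ∁ W ∣
restrict [] [] = []
restrict (inside ∷ W) (_ ∷ S) = restrict W S
restrict (outside ∷ W) (x ∷ S) = x ∷ restrict W S

Avoids : Subset n → Subset n → Set
Avoids W S = ¬ Nonempty (S ∩ W)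

avoids-tail : ∀ x y (W S : Subset n) → Avoids (x ∷ W) (y ∷ S) → Avoids W S
avoids-tail x y W S av (i , i∈) = av (suc i , there i∈)

∣restrict∣ : (W S : Subset n) → Avoids W S → ∣ restrict W S ∣ ≡ ∣ S ∣
∣restrict∣ [] [] av = refl
∣restrict∣ (inside ∷ W) (inside ∷ S) av = contradiction (zero , here) av
∣restrict∣ (inside ∷ W) (outside ∷ S) av = ∣restrict∣ W S (avoids-tail inside outside W S av)
∣restrict∣ (outside ∷ W) (inside ∷ S) av = cong suc (∣restrict∣ W S (avoids-tail outside inside W S av))
∣restrict∣ (outside ∷ W) (outside ∷ S) av = ∣restrict∣ W S (avoids-tail outside outside W S av)

restrict-injective : (W S S′ : Subset n) → Avoids W S → Avoids W S′ → restrict W S ≡ restrict W S′ → S ≡ S′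
restrict-injective [] [] [] _ _ _ = refl
restrict-injective (inside ∷ W) (inside ∷ S) _ av _ _ = contradiction (zero , here) av
restrict-injective (inside ∷ W) (outside ∷ S) (inside ∷ S′) _ av _ = contradiction (zero , here) av
restrict-injective (inside ∷ W) (outside ∷ S) (outside ∷ S′) av av′ eq =
  cong (outside ∷_) (restrict-injective W S S′ (avoids-tail inside outside W S av) (avoids-tail inside outside W S′ av′) eq)
restrict-injective (outside ∷ W) (x ∷ S) (y ∷ S′) av av′ eq =
  cong₂ _∷_ (Vec.∷-injectiveˡ eq)
    (restrict-injective W S S′ (avoids-tail outside x W S av) (avoids-tail outside y W S′ av′) (Vec.∷-injectiveʳ eq))

-- A decomposition into classes of one block is merely a numbering of the k-sets. It requires k ≤ n;
-- for larger k there are no sets to number.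
enumerate : ∀ n k → ∃ λ (index : ∀ (S : Subset n) → ∣ S ∣ ≡ k → Fin (n C k)) →
  ∀ S S′ p q → index S p ≡ index S′ q → S ≡ S′
enumerate n k with k ≤? n
... | no k≰n = (λ S p → contradiction (subst (_≤ n) p (∣p∣≤n S)) k≰n)
             , (λ S S′ p _ _ → contradiction (subst (_≤ n) p (∣p∣≤n S)) k≰n)
... | yes k≤n = (λ S p → proj₁ (surjective S p))
             , (λ S S′ p q eq → trans (sym (proj₂ (surjective S p))) (trans (cong block eq) (proj₂ (surjective S′ q))))
  where open Decomposition (baranyai n k 1 (subst (_≤ n) (sym (*-identityˡ k)) k≤n))

-- Each j rules out at most z values, `few` expressing this by an injection into `Fin z`, and the
-- other indices occupy fewer than e. If no value were left, labelling each one as occupied or bad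
-- would inject `Fin M` into a smaller set.
greedy : ∀ e {M z} (Bad : Fin e → Fin M → Set) (bad? : ∀ j i → Dec (Bad j i)) →
  (∀ j → ∃ λ (h : ∀ i → Bad j i → Fin z) → ∀ i i′ b b′ → h i b ≡ h i′ b′ → i ≡ i′) → e + z ≤ M →
  ∃ λ (g : Fin e → Fin M) → (∀ j j′ → g j ≡ g j′ → j ≡ j′) × (∀ j → ¬ Bad j (g j))
greedy zero Bad bad? few e+z≤M = (λ ()) , (λ ()) , λ ()
greedy (suc e) {M} {z} Bad bad? few e+z≤M
  with g , g-inj , good ← greedy e (Bad ∘ suc) (bad? ∘ suc) (few ∘ suc) (<⇒≤ e+z≤M)
  with Fin.any? (λ i → ¬? (bad? zero i) ×-dec ¬? (Fin.any? λ j → g j Fin.≟ i))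
... | yes (i , ¬bad , fresh) = g⁺ , g⁺-inj , good⁺
  where
  g⁺ : Fin (suc e) → Fin M
  g⁺ zero = i
  g⁺ (suc j) = g j
  g⁺-inj : ∀ j j′ → g⁺ j ≡ g⁺ j′ → j ≡ j′
  g⁺-inj zero zero _ = refl
  g⁺-inj zero (suc j′) eq = contradiction (j′ , sym eq) fresh
  g⁺-inj (suc j) zero eq = contradiction (j , eq) fresh
  g⁺-inj (suc j) (suc j′) eq = cong suc (g-inj j j′ eq)
  good⁺ : ∀ j → ¬ Bad j (g⁺ j)
  good⁺ zero = ¬bad
  good⁺ (suc j) = good j
... | no none = contradiction e+z≤M (≤⇒≯ (Fin.injective⇒≤ {f = join e z ∘ label} λ {i} {i′} eq →
      label-injective i i′ (trans (sym (Fin.splitAt-join e z (label i))) (trans (cong (splitAt e) eq) (Fin.splitAt-join e z (label i′))))))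
  where
  taken : ∀ i → (∃ λ j → g j ≡ i) ⊎ Bad zero i
  taken i with Fin.any? (λ j → g j Fin.≟ i) | bad? zero i
  ... | yes used | _ = inj₁ used
  ... | no _ | yes b = inj₂ b
  ... | no ¬used | no ¬b = contradiction (i , ¬b , ¬used) none
  label : Fin M → Fin e ⊎ Fin z
  label i with taken i
  ... | inj₁ (j , _) = inj₁ j
  ... | inj₂ b = inj₂ (proj₁ (few zero) i b)
  label-injective : ∀ i i′ → label i ≡ label i′ → i ≡ i′
  label-injective i i′ eq with taken i | taken i′
  ... | inj₁ (j , p) | inj₁ (j′ , q) = trans (sym p) (trans (cong g (inj₁-injective eq)) q)
  ... | inj₂ b | inj₂ b′ = proj₂ (few zero) i i′ b b′ (inj₂-injective eq)

-- The bound on e makes the first e classes full: class j consists of the blocks with index j c + a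
-- for a < c.
module Classes {n k c : ℕ} .{{_ : NonZero c}} (D : Decomposition n k c) {e : ℕ} (ec≤C : e * c ≤ n C k) where
  open Decomposition D

  slot : Fin e → Fin c → Fin (n C k)
  slot j a = inject≤ (combine j a) ec≤C

  slot-injective : ∀ {j a j′ a′} → slot j a ≡ slot j′ a′ → j ≡ j′ × a ≡ a′
  slot-injective {j} {a} {j′} {a′} eq = Fin.combine-injective j a j′ a′ (Fin.inject≤-injective ec≤C ec≤C _ _ eq)

  slot-class : ∀ j a → toℕ (slot j a) / c ≡ toℕ j
  slot-class j a = begin
    toℕ (slot j a) / c ≡⟨ cong (_/ c) (trans (Fin.toℕ-inject≤ (combine j a) ec≤C) (Fin.toℕ-combine j a)) ⟩
    (c * toℕ j + toℕ a) / c ≡⟨ cong (λ x → (x + toℕ a) / c) (*-comm c (toℕ j)) ⟩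
    (toℕ j * c + toℕ a) / c ≡⟨ +-distrib-/-∣ˡ (toℕ a) (n∣m*n (toℕ j)) ⟩
    toℕ j * c / c + toℕ a / c ≡⟨ cong₂ _+_ (m*n/n≡m (toℕ j) c) (m<n⇒m/n≡0 (Fin.toℕ<n a)) ⟩
    toℕ j + 0 ≡⟨ +-identityʳ _ ⟩
    toℕ j ∎
    where open ≡-Reasoning

  part : Fin e → Fin c → Subset n
  part j a = block (slot j a)

  part-size : ∀ j a → ∣ part j a ∣ ≡ k
  part-size j a = size (slot j a)

  part-class : ∀ {j a j′ a′} → part j a ≡ part j′ a′ → j ≡ j′
  part-class = proj₁ ∘ slot-injective ∘ injective

  part-disjoint : ∀ j → Disjoint (part j)
  part-disjoint j a a′ a≢a′ = disjoint (slot j a) (slot j a′)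
    (trans (slot-class j a) (sym (slot-class j a′))) (a≢a′ ∘ proj₂ ∘ slot-injective)

module _ {N K e s : ℕ} (sK≤N : suc s * K ≤ N) (es≤C : e * suc s ≤ N C K) where

  private
    K≤N : K ≤ N
    K≤N = ≤-trans (m≤m+n K (s * K)) sK≤N

    stars : Decomposition (suc N) K 1
    stars = baranyai (suc N) K 1 (subst (_≤ suc N) (sym (*-identityˡ K)) (m≤n⇒m≤1+n K≤N))

    module A = Classes (baranyai N K (suc s) sK≤N) {e} es≤C

  -- Each sunflower leaves fewer than K of the N points uncovered, so its petals alone meet every
  -- K-set.
  minor-of-sunflowers : N < suc s * K + K → CompleteMinor (KneserComplement (2 + N) (suc K)) ((suc N C K) + e)
  minor-of-sunflowers large = twoStarMinor {c = 0} stars A.part A.part-size A.part-class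
    (λ _ ()) (λ _ ()) (λ { {a = ()} }) (λ _ ())
    (λ j S S≡K → inj₁ (large-family-meets (A.part j) (A.part-size j) (A.part-disjoint j) S
      (subst (λ x → N < suc s * K + x) (sym S≡K) large)))

  -- A block that avoids the sunflower `W j` spoils only its own class, so at most z classes are bad
  -- for j. The class chosen by `greedy` hangs on the petals block by block, and leaves fewer than K
  -- points uncovered.
  minor-of-glued-classes : ∀ c .{{_ : NonZero c}} → c * suc K ≤ N → N < c * suc K + K →
    (e + ((N ∸ suc s * K) C suc K)) * c ≤ N C suc K →
    CompleteMinor (KneserComplement (2 + N) (suc K)) ((suc N C K) + e)
  minor-of-glued-classes c cK≤N large room =
    glue (greedy e Bad bad? few ≤-refl)
    where
    z M : ℕ
    z = (N ∸ suc s * K) C suc K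
    M = e + z
    module B = Classes (baranyai N (suc K) c cK≤N) {M} room
    W : Fin e → Subset N
    W j = ⋃ (A.part j)
    Bad : Fin e → Fin M → Set
    Bad j i = ∃ λ a → Avoids (W j) (B.part i a)
    bad? : ∀ j i → Dec (Bad j i)
    bad? j i = Fin.any? (λ a → ¬? (nonempty? (B.part i a ∩ W j)))
    free : ∀ j → ∣ ∁ (W j) ∣ ≡ N ∸ suc s * K
    free j = trans (∣∁p∣≡n∸∣p∣ (W j)) (cong (N ∸_) (∣⋃∣ (A.part j) (A.part-size j) (A.part-disjoint j)))
    few : ∀ j → ∃ λ (h : ∀ i → Bad j i → Fin z) → ∀ i i′ b b′ → h i b ≡ h i′ b′ → i ≡ i′
    few j with index , index-inj ← enumerate ∣ ∁ (W j) ∣ (suc K) =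
      subst (λ x → ∃ λ (h : ∀ i → Bad j i → Fin (x C suc K)) → ∀ i i′ b b′ → h i b ≡ h i′ b′ → i ≡ i′) (free j)
        ( (λ i (a , av) → index (restrict (W j) (B.part i a)) (trans (∣restrict∣ (W j) _ av) (B.part-size i a)))
        , (λ i i′ (a , av) (a′ , av′) eq →
            B.part-class (restrict-injective (W j) _ _ av av′ (index-inj _ _ _ _ eq))))
    glue : (∃ λ (g : Fin e → Fin M) → (∀ j j′ → g j ≡ g j′ → j ≡ j′) × (∀ j → ¬ Bad j (g j))) →
      CompleteMinor (KneserComplement (2 + N) (suc K)) ((suc N C K) + e)
    glue (g , g-inj , good) = twoStarMinor {c = c} stars A.part A.part-size A.part-class
      (B.part ∘ g) (B.part-size ∘ g) (g-inj _ _ ∘ B.part-class) touches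
      (λ j S S≡K → inj₂ (large-family-meets (B.part (g j)) (B.part-size (g j)) (B.part-disjoint (g j)) S
        (subst (λ x → N < c * suc K + x) (sym S≡K) large)))
      where
      touches : ∀ j a → ∃ λ b → Nonempty (B.part (g j) a ∩ A.part j b)
      touches j a with nonempty? (B.part (g j) a ∩ W j)
      ... | no av = contradiction (a , av) (good j)
      ... | yes (x , x∈) = let p , q = x∈p∩q⁻ (B.part (g j) a) (W j) x∈ ; b , r = ∈-⋃⁻ (A.part j) q in
        b , x , x∈p∩q⁺ (p , r)

open ≤-Reasoning

-- Estimates for binomial coefficients

C-pos : ∀ {j m} → j ≤ m → 1 ≤ m C j
C-pos {zero} _ = ≤-refl
C-pos {suc j} {suc m} (s≤s j≤m) = begin
  1 ≤⟨ C-pos j≤m ⟩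
  m C j ≤⟨ m≤m+n _ _ ⟩
  (m C j) + (m C suc j) ≡⟨ nCk+nC[k+1]≡[n+1]C[k+1] m j ⟩
  suc m C suc j ∎

C-monoˡ : ∀ j {m n} → m ≤ n → m C j ≤ n C j
C-monoˡ j m≤n = go j (≤⇒≤′ m≤n)
  where
  up : ∀ j n → n C j ≤ suc n C j
  up zero n = ≤-refl
  up (suc j) n = ≤-trans (m≤n+m _ (n C j)) (≤-reflexive (nCk+nC[k+1]≡[n+1]C[k+1] n j))
  go : ∀ j {m n} → m ≤′ n → m C j ≤ n C j
  go j ≤′-refl = ≤-refl
  go j (≤′-step m≤′n) = ≤-trans (go j m≤′n) (up j _)

n≤nCj : ∀ {j m} → 1 ≤ j → j < m → m ≤ m C j
n≤nCj {suc zero} {m} _ _ = ≤-reflexive (sym (nC1≡n m))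
n≤nCj {suc (suc j)} {suc m} _ (s≤s j+2≤m) = ≤-trans bound (≤-reflexive (nCk+nC[k+1]≡[n+1]C[k+1] m (suc j)))
  where
  bound : suc m ≤ (m C suc j) + (m C suc (suc j))
  bound with suc (suc j) ≤? m | suc (suc (suc j)) ≤? m
  ... | _ | yes j+3≤m = +-mono-≤ (C-pos (<⇒≤ j+2≤m)) (n≤nCj (s≤s z≤n) j+3≤m)
  ... | _ | no _ = ≤-trans (≤-reflexive (+-comm 1 m)) (+-mono-≤ (n≤nCj (s≤s z≤n) j+2≤m) (C-pos j+2≤m))

n[n-1]≤2nC[n-2] : ∀ j → (4 + j) * (3 + j) ≤ 2 * ((4 + j) C (2 + j))
n[n-1]≤2nC[n-2] zero = ≤-refl
n[n-1]≤2nC[n-2] (suc j) = begin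
  (5 + j) * (4 + j) ≡⟨ expand j ⟩
  (4 + j) * (3 + j) + 2 * (4 + j) ≤⟨ +-mono-≤ (n[n-1]≤2nC[n-2] j) (*-monoʳ-≤ 2 (n≤nCj {3 + j} {4 + j} (s≤s z≤n) ≤-refl)) ⟩
  2 * ((4 + j) C (2 + j)) + 2 * ((4 + j) C (3 + j)) ≡⟨ *-distribˡ-+ 2 ((4 + j) C (2 + j)) _ ⟨
  2 * (((4 + j) C (2 + j)) + ((4 + j) C (3 + j))) ≡⟨ cong (2 *_) (nCk+nC[k+1]≡[n+1]C[k+1] (4 + j) (2 + j)) ⟩
  2 * ((5 + j) C (3 + j)) ∎
  where
  expand : ∀ j → (5 + j) * (4 + j) ≡ (4 + j) * (3 + j) + 2 * (4 + j)
  expand = solve-∀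

-- This is C(n,2) ≤ C(n,j) for 2 ≤ j ≤ n - 2. Pascal's rule gives the induction on n, with j = n - 2
-- as the boundary case.
n[n-1]≤2nCj : ∀ {j m} → 2 ≤ j → 1 + j ≤ m → suc m * m ≤ 2 * (suc m C j)
n[n-1]≤2nCj {suc zero} (s≤s ()) _
n[n-1]≤2nCj {suc (suc j)} {suc m} 2≤j (s≤s j+2≤m) with suc (suc (suc j)) ≤? m
... | no j+3≰m with ≤-antisym j+2≤m (s≤s⁻¹ (≰⇒> j+3≰m))
...   | refl = n[n-1]≤2nC[n-2] j
n[n-1]≤2nCj {suc (suc j)} {suc m} 2≤j (s≤s j+2≤m) | yes j+3≤m = begin
  (2 + m) * suc m ≡⟨ expand m ⟩
  2 * suc m + suc m * m ≤⟨ +-mono-≤ (*-monoʳ-≤ 2 (n≤nCj (s≤s z≤n) (s≤s (<⇒≤ j+2≤m)))) (n[n-1]≤2nCj 2≤j j+3≤m) ⟩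
  2 * (suc m C suc j) + 2 * (suc m C suc (suc j)) ≡⟨ *-distribˡ-+ 2 (suc m C suc j) _ ⟨
  2 * ((suc m C suc j) + (suc m C suc (suc j))) ≡⟨ cong (2 *_) (nCk+nC[k+1]≡[n+1]C[k+1] (suc m) (suc j)) ⟩
  2 * (suc (suc m) C suc (suc j)) ∎
  where
  expand : ∀ m → (2 + m) * (1 + m) ≡ 2 * (1 + m) + (1 + m) * m
  expand = solve-∀

descend : ∀ j d → suc j * ((j + d) C suc j) ≡ d * ((j + d) C j)
descend j d = +-cancelˡ-≡ (suc j * ((j + d) C j)) _ _ (begin-equality
  suc j * ((j + d) C j) + suc j * ((j + d) C suc j) ≡⟨ *-distribˡ-+ (suc j) ((j + d) C j) _ ⟨
  suc j * (((j + d) C j) + ((j + d) C suc j)) ≡⟨ cong (suc j *_) (nCk+nC[k+1]≡[n+1]C[k+1] (j + d) j) ⟩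
  suc j * (suc (j + d) C suc j) ≡⟨ absorption (j + d) j ⟩
  suc (j + d) * ((j + d) C j) ≡⟨ *-distribʳ-+ ((j + d) C j) (suc j) d ⟩
  suc j * ((j + d) C j) + d * ((j + d) C j) ∎)

absorption-top : ∀ j d → suc d * (suc (j + d) C j) ≡ suc (j + d) * ((j + d) C j)
absorption-top zero d = refl
absorption-top (suc j) d = +-cancelˡ-≡ (suc j * (suc (suc j + d) C suc j)) _ _ (begin-equality
  suc j * c₁ + suc d * c₁ ≡⟨ *-distribʳ-+ c₁ (suc j) (suc d) ⟨
  (suc j + suc d) * c₁ ≡⟨ cong (_* c₁) (+-suc (suc j) d) ⟩
  M * c₁ ≡⟨ cong (M *_) (nCk+nC[k+1]≡[n+1]C[k+1] (suc j + d) j) ⟨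
  M * (((suc j + d) C j) + ((suc j + d) C suc j)) ≡⟨ *-distribˡ-+ M ((suc j + d) C j) _ ⟩
  M * ((suc j + d) C j) + M * ((suc j + d) C suc j) ≡⟨ cong (_+ M * ((suc j + d) C suc j)) (absorption (suc j + d) j) ⟨
  suc j * c₁ + M * ((suc j + d) C suc j) ∎)
  where
  M = suc (suc j + d)
  c₁ = M C suc j

-- The two terms of Vandermonde's convolution that take no element, or exactly one, from the part of
-- size c.
vandermonde-≤ : ∀ c b j → (b C suc j) + c * (b C j) ≤ (c + b) C suc j
vandermonde-≤ zero b j = ≤-reflexive (+-identityʳ _)
vandermonde-≤ (suc c) b j = begin
  (b C suc j) + (b C j + c * (b C j)) ≡⟨ swap (b C suc j) (b C j) (c * (b C j)) ⟩
  b C j + ((b C suc j) + c * (b C j)) ≤⟨ +-mono-≤ (C-monoˡ j (m≤n+m b c)) (vandermonde-≤ c b j) ⟩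
  (c + b) C j + (c + b) C suc j ≡⟨ nCk+nC[k+1]≡[n+1]C[k+1] (c + b) j ⟩
  (suc c + b) C suc j ∎
  where
  swap : ∀ x y z → x + (y + z) ≡ y + (x + z)
  swap = solve-∀

descend₂ : ∀ j d → (2 + j) * (1 + j) * ((j + suc d) C (2 + j)) ≡ d * suc d * ((j + suc d) C j)
descend₂ j d = begin-equality
  (2 + j) * (1 + j) * c₂ ≡⟨ shuffle (1 + j) c₂ ⟩
  (1 + j) * ((2 + j) * c₂) ≡⟨ cong ((1 + j) *_) once ⟩
  (1 + j) * (d * c₁) ≡⟨ swap (1 + j) d c₁ ⟩
  d * ((1 + j) * c₁) ≡⟨ cong (d *_) (descend j (suc d)) ⟩
  d * (suc d * c₀) ≡⟨ *-assoc d (suc d) c₀ ⟨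
  d * suc d * c₀ ∎
  where
  c₀ = (j + suc d) C j
  c₁ = (j + suc d) C (1 + j)
  c₂ = (j + suc d) C (2 + j)
  shuffle : ∀ x c → (1 + x) * x * c ≡ x * ((1 + x) * c)
  shuffle = solve-∀
  swap : ∀ x d c → x * (d * c) ≡ d * (x * c)
  swap = solve-∀
  once : (2 + j) * c₂ ≡ d * c₁
  once = subst (λ m → (2 + j) * (m C (2 + j)) ≡ d * (m C (1 + j))) (sym (+-suc j d)) (descend (suc j) d)

-- Here and below j = k - 2, and b is the number of points outside a sunflower
-- (an upper bound for it if q ≥ 3), so that C(b,k) blocks miss the sunflower.
few-blocks-miss : ∀ i r → r ≤ 2 + i → let j = suc i ; b = j + suc (i + r) in
  (b C (2 + j)) < ((j + 4) + b) C j
-- The summand j + 4 is N - b for q = 3. Both sides are compared with `c₀`: the left one by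
-- `descend₂`, the right one through two Vandermonde terms. Clearing denominators by 2(j+1)(j+2)
-- leaves a polynomial inequality in j.
few-blocks-miss i r r≤ = ≰⇒> λ le → contradiction (begin
  suc (8 * (j * j) + 4 * j) * c₀ ≤⟨ *-monoˡ-≤ c₀ poly ⟩
  (2 + j) * (2 * (1 + j) + (j + 4) * j) * c₀ ≡⟨ regroup j c₀ ⟩
  2 * ((2 + j) * (1 + j) * c₀) + (2 + j) * (j + 4) * (j * c₀) ≤⟨ +-monoʳ-≤ (2 * ((2 + j) * (1 + j) * c₀)) (*-monoʳ-≤ ((2 + j) * (j + 4)) jc₀≤) ⟩
  2 * ((2 + j) * (1 + j) * c₀) + (2 + j) * (j + 4) * ((2 + 2 * j) * c₋) ≡⟨ collect j c₀ c₋ ⟩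
  2 * ((2 + j) * (1 + j) * (c₀ + (j + 4) * c₋)) ≤⟨ *-monoʳ-≤ 2 (*-monoʳ-≤ ((2 + j) * (1 + j)) (≤-trans (vandermonde-≤ (j + 4) b i) le)) ⟩
  2 * ((2 + j) * (1 + j) * (b C (2 + j))) ≡⟨ cong (2 *_) (descend₂ j (i + r)) ⟩
  2 * ((i + r) * suc (i + r) * c₀) ≤⟨ *-monoʳ-≤ 2 (*-monoˡ-≤ c₀ (*-mono-≤ i+r≤ (s≤s i+r≤))) ⟩
  2 * ((2 * j) * (1 + 2 * j) * c₀) ≡⟨ double j c₀ ⟩
  (8 * (j * j) + 4 * j) * c₀ ∎) (<⇒≱ (*-monoˡ-< c₀ {{>-nonZero c₀>0}} (n<1+n (8 * (j * j) + 4 * j))))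
  where
  j = suc i
  b = j + suc (i + r)
  c₀ = b C j
  c₋ = b C i
  c₀>0 : 0 < c₀
  c₀>0 = C-pos (m≤m+n j _)
  i+r≤ : i + r ≤ 2 * j
  i+r≤ = ≤-trans (+-monoʳ-≤ i r≤) (≤-reflexive (two i))
    where
    two : ∀ i → i + (2 + i) ≡ 2 * (1 + i)
    two = solve-∀
  jc₀≤ : j * c₀ ≤ (2 + 2 * j) * c₋
  jc₀≤ = begin
    j * c₀ ≡⟨ subst (λ m → j * (m C j) ≡ (2 + (i + r)) * (m C i)) (+-suc i (suc (i + r))) (descend i (2 + (i + r))) ⟩
    (2 + (i + r)) * c₋ ≤⟨ *-monoˡ-≤ c₋ (+-monoʳ-≤ 2 i+r≤) ⟩
    (2 + 2 * j) * c₋ ∎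
  regroup : ∀ j c → (2 + j) * (2 * (1 + j) + (j + 4) * j) * c ≡ 2 * ((2 + j) * (1 + j) * c) + (2 + j) * (j + 4) * (j * c)
  regroup = solve-∀
  collect : ∀ j c d → 2 * ((2 + j) * (1 + j) * c) + (2 + j) * (j + 4) * ((2 + 2 * j) * d) ≡ 2 * ((2 + j) * (1 + j) * (c + (j + 4) * d))
  collect = solve-∀
  double : ∀ j c → 2 * ((2 * j) * (1 + 2 * j) * c) ≡ (8 * (j * j) + 4 * j) * c
  double = solve-∀
  poly : suc (8 * (j * j) + 4 * j) ≤ (2 + j) * (2 * (1 + j) + (j + 4) * j)
  poly = ≤-trans (m≤m+n _ (j * (j * j) + 10 * j + 3)) (≤-reflexive (eq j))
    where
    eq : ∀ j → 1 + (8 * (j * j) + 4 * j) + (j * (j * j) + 10 * j + 3) ≡ (2 + j) * (2 * (1 + j) + (j + 4) * j)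
    eq = solve-∀

-- The case q = 2.
half-blocks-miss : ∀ i r → 2 ≤ r → r ≤ 3 + i → let j = 2 + i ; b = j + suc r in
  suc (2 * (b C (2 + j))) ≤ ((j + 1) + b) C j
half-blocks-miss i r 2≤r r≤ = begin
  suc (2 * (b C (2 + j))) ≤⟨ s≤s (*-monoʳ-≤ 2 z≤c₀) ⟩
  suc (2 * c₀) ≡⟨ two c₀ ⟩
  c₀ + suc c₀ ≤⟨ +-monoʳ-≤ c₀ (*-cancelˡ-≤ (2 + r) big) ⟩
  c₀ + (j + 1) * c₋ ≤⟨ vandermonde-≤ (j + 1) b (suc i) ⟩
  ((j + 1) + b) C j ∎
  where
  j = 2 + i
  b = j + suc r
  c₀ = b C j
  c₋ = b C suc i
  two : ∀ c → 1 + 2 * c ≡ c + (1 + c)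
  two = solve-∀
  z≤c₀ : b C (2 + j) ≤ c₀
  z≤c₀ = *-cancelˡ-≤ ((2 + j) * (1 + j)) (begin
    (2 + j) * (1 + j) * (b C (2 + j)) ≡⟨ descend₂ j r ⟩
    r * suc r * c₀ ≤⟨ *-monoˡ-≤ c₀ (≤-trans (≤-reflexive (*-comm r (suc r))) (*-mono-≤ (s≤s r≤) r≤)) ⟩
    (2 + j) * (1 + j) * c₀ ∎)
  b≤c₀ : b ≤ c₀
  b≤c₀ = n≤nCj (s≤s z≤n) (subst (j <_) (sym (+-suc j r)) (s≤s (m≤m+n j r)))
  -- As (2 + r) `c₋` = j `c₀`, the right side is (j+1) j `c₀`. On the left, r ≤ j + 1, and the stray
  -- 5 + i is absorbed by one more `c₀` ≥ b.
  big : (2 + r) * suc c₀ ≤ (2 + r) * ((j + 1) * c₋)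
  big = begin
    (2 + r) * suc c₀ ≤⟨ *-monoˡ-≤ (suc c₀) (+-monoʳ-≤ 2 r≤) ⟩
    (5 + i) * suc c₀ ≡⟨ *-suc (5 + i) c₀ ⟩
    (5 + i) + (5 + i) * c₀ ≤⟨ +-monoˡ-≤ ((5 + i) * c₀) (≤-trans 5+i≤b b≤c₀) ⟩
    (6 + i) * c₀ ≤⟨ *-monoˡ-≤ c₀ poly ⟩
    (j + 1) * j * c₀ ≡⟨ *-assoc (j + 1) j c₀ ⟩
    (j + 1) * (j * c₀) ≡⟨ cong ((j + 1) *_) (subst (λ m → j * (m C j) ≡ (2 + r) * (m C suc i)) (+-suc (suc i) (suc r)) (descend (suc i) (2 + r))) ⟩
    (j + 1) * ((2 + r) * c₋) ≡⟨ swap (j + 1) (2 + r) c₋ ⟩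
    (2 + r) * ((j + 1) * c₋) ∎
    where
    swap : ∀ x y z → x * (y * z) ≡ y * (x * z)
    swap = solve-∀
    5+i≤b : 5 + i ≤ b
    5+i≤b = ≤-trans (≤-reflexive (shape i)) (+-monoʳ-≤ j (s≤s 2≤r))
      where
      shape : ∀ i → 5 + i ≡ 2 + i + 3
      shape = solve-∀
    poly : 6 + i ≤ (j + 1) * j
    poly = ≤-trans (m≤m+n _ (i * i + 4 * i)) (≤-reflexive (eq i))
      where
      eq : ∀ i → 6 + i + (i * i + 4 * i) ≡ (2 + i + 1) * (2 + i)
      eq = solve-∀

-- Parameters, and inequalities for the numbers of petals and blocks

quotient : ∀ K m .{{_ : NonZero K}} → K ≤ m → ∃ λ s → suc s * K ≤ m × m < suc s * K + K
quotient K m K≤m = (m ∸ K) / K , lower , upper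
  where
  s = (m ∸ K) / K
  lower : suc s * K ≤ m
  lower = ≤-trans (+-monoʳ-≤ K (m/n*n≤m (m ∸ K) K)) (≤-reflexive (m+[n∸m]≡n K≤m))
  upper : m < suc s * K + K
  upper = begin-strict
    m ≡⟨ m+[n∸m]≡n K≤m ⟨
    K + (m ∸ K) ≡⟨ cong (K +_) (m≡m%n+[m/n]*n (m ∸ K) K) ⟩
    K + ((m ∸ K) % K + s * K) <⟨ +-monoʳ-< K (+-monoˡ-< (s * K) (m%n<n (m ∸ K) K)) ⟩
    K + (K + s * K) ≡⟨ +-comm K _ ⟩
    suc s * K + K ∎

-- The case r = 1 with n - k = u + 2. If e m > X, multiplying by K(N+1) gives K(u+2) C₁ + K(N+1) ≤
-- (C₁ + u + 1) N. But K ≥ 2 yields K(u+2) ≥ N + (u+1), and since C₁ ≥ N + 1 the surplus (u+1) C₁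
-- exceeds (u+1) N.
sunflowers-fit : ∀ i u C₁ X e m → let K = 2 + i ; N = K + suc u in
  (2 + u) * C₁ ≡ suc N * X → suc N ≤ C₁ → suc N * e ≤ C₁ + suc u → m * K ≤ N → e * m ≤ X
sunflowers-fit i u C₁ X e m top C₁-large e-small mK≤N = ≮⇒≥ λ X<em → <-irrefl refl (begin-strict
  (C₁ + suc u) * N <⟨ m<m+n _ (s≤s z≤n) ⟩
  (C₁ + suc u) * N + (K * suc N + suc u) ≡⟨ expand i u C₁ ⟩
  suc u * suc N + (N * C₁ + K * suc N) ≤⟨ +-monoˡ-≤ _ (*-monoʳ-≤ (suc u) C₁-large) ⟩
  suc u * C₁ + (N * C₁ + K * suc N) ≤⟨ m≤m+n _ (i * (suc u * C₁)) ⟩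
  suc u * C₁ + (N * C₁ + K * suc N) + i * (suc u * C₁) ≡⟨ gather i u C₁ ⟩
  K * ((2 + u) * C₁) + K * suc N ≡⟨ cong (λ x → K * x + K * suc N) top ⟩
  K * (suc N * X) + K * suc N ≡⟨ successor K (suc N) X ⟩
  K * (suc N * suc X) ≤⟨ *-monoʳ-≤ K (*-monoʳ-≤ (suc N) X<em) ⟩
  K * (suc N * (e * m)) ≡⟨ shuffle K (suc N) e m ⟩
  suc N * e * (m * K) ≤⟨ *-mono-≤ e-small mK≤N ⟩
  (C₁ + suc u) * N ∎)
  where
  K = 2 + i
  N = K + suc u
  expand : ∀ i u c → (c + (1 + u)) * (2 + i + (1 + u)) + ((2 + i) * (1 + (2 + i + (1 + u))) + (1 + u)) ≡
    (1 + u) * (1 + (2 + i + (1 + u))) + ((2 + i + (1 + u)) * c + (2 + i) * (1 + (2 + i + (1 + u))))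
  expand = solve-∀
  gather : ∀ i u c → (1 + u) * c + ((2 + i + (1 + u)) * c + (2 + i) * (1 + (2 + i + (1 + u)))) + i * ((1 + u) * c) ≡
    (2 + i) * ((2 + u) * c) + (2 + i) * (1 + (2 + i + (1 + u)))
  gather = solve-∀
  successor : ∀ K n x → K * (n * x) + K * n ≡ K * (n * (1 + x))
  successor = solve-∀
  shuffle : ∀ K n e m → K * (n * (e * m)) ≡ n * e * (m * K)
  shuffle = solve-∀

-- q = p′ + 2 and k = K′ + 2 with n = N + 2 = qk + r, so that u = pk - 1 and a = n - k.
module Parameters (p′ K′ r : ℕ) where

  K k p q u a N : ℕ
  K = suc K′
  k = suc K
  p = suc p′
  q = suc p
  u = K + p′ * k
  a = suc (u + r)
  N = K′ + a

  n≡qk+r : 2 + N ≡ q * k + r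
  n≡qk+r = eq p′ K′ r
    where
    eq : ∀ p K r → 2 + (K + (1 + (1 + K + p * (2 + K) + r))) ≡ (2 + p) * (2 + K) + r
    eq = solve-∀

  -- Up to rounding, e s ≤ (r C₁ / (kq)) (pk / K) ≤ (p/q) C₁ = p(N+1) X / (qa), where r ≤ K is used.
  -- This is below X because qa = p(N+1) + (r+p). The surplus r + p pays for rounding e up, since C₁
  -- is at least N(N+1)/2.
  glued-sunflowers-fit : ∀ C₁ X e s → 2 ≤ r → r ≤ K → a * C₁ ≡ suc N * X → suc N * N ≤ 2 * C₁ →
    k * (e * q) ≤ r * C₁ + k * p → s * K ≤ p * k → e * s ≤ X
  glued-sunflowers-fit C₁ X e s 2≤r r≤K top C₁-large e-small sK≤pk = ≮⇒≥ λ X<es → <-irrefl refl (begin-strict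
    2 * (suc N * (p * (r * C₁ + k * p))) ≡⟨ expand (suc N) p r C₁ k ⟩
    2 * (r * (p * suc N * C₁)) + 2 * p * (suc N * (p * k)) ≤⟨ +-monoʳ-≤ _ (*-mono-≤ 2p≤ (*-monoʳ-≤ (suc N) pk≤N)) ⟩
    2 * (r * (p * suc N * C₁)) + r * (r + p) * (suc N * N) ≤⟨ +-monoʳ-≤ _ (*-monoʳ-≤ (r * (r + p)) C₁-large) ⟩
    2 * (r * (p * suc N * C₁)) + r * (r + p) * (2 * C₁) ≡⟨ gather r p (suc N) C₁ ⟩
    2 * (r * ((p * suc N + (r + p)) * C₁)) ≡⟨ cong (λ x → 2 * (r * (x * C₁))) qa ⟨
    2 * (r * (q * a * C₁)) ≤⟨ *-monoʳ-≤ 2 (*-monoˡ-≤ (q * a * C₁) r≤K) ⟩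
    2 * (K * (q * a * C₁)) <⟨ *-monoʳ-< 2 (m<m+n (K * (q * a * C₁)) (s≤s z≤n)) ⟩
    2 * (K * (q * a * C₁) + K * q * suc N) ≡⟨ cong (2 *_) (regroup K q a C₁ (suc N)) ⟩
    2 * (K * q * (a * C₁) + K * q * suc N) ≡⟨ cong (λ x → 2 * (K * q * x + K * q * suc N)) top ⟩
    2 * (K * q * (suc N * X) + K * q * suc N) ≡⟨ cong (2 *_) (successor (K * q) (suc N) X) ⟩
    2 * (K * q * (suc N * suc X)) ≤⟨ *-monoʳ-≤ 2 (*-monoʳ-≤ (K * q) (*-monoʳ-≤ (suc N) X<es)) ⟩
    2 * (K * q * (suc N * (e * s))) ≡⟨ cong (2 *_) (shuffle K q (suc N) e s) ⟩
    2 * (suc N * (e * q * (s * K))) ≤⟨ *-monoʳ-≤ 2 (*-monoʳ-≤ (suc N) (*-monoʳ-≤ (e * q) sK≤pk)) ⟩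
    2 * (suc N * (e * q * (p * k))) ≡⟨ cong (λ x → 2 * (suc N * x)) (rotate (e * q) p k) ⟩
    2 * (suc N * (p * (k * (e * q)))) ≤⟨ *-monoʳ-≤ 2 (*-monoʳ-≤ (suc N) (*-monoʳ-≤ p e-small)) ⟩
    2 * (suc N * (p * (r * C₁ + k * p))) ∎)
    where
    expand : ∀ n p r c k → 2 * (n * (p * (r * c + k * p))) ≡ 2 * (r * (p * n * c)) + 2 * p * (n * (p * k))
    expand = solve-∀
    gather : ∀ r p n c → 2 * (r * (p * n * c)) + r * (r + p) * (2 * c) ≡ 2 * (r * ((p * n + (r + p)) * c))
    gather = solve-∀
    regroup : ∀ K q a c n → K * (q * a * c) + K * q * n ≡ K * q * (a * c) + K * q * n
    regroup = solve-∀
    successor : ∀ K n x → K * (n * x) + K * n ≡ K * (n * (1 + x))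
    successor = solve-∀
    shuffle : ∀ K q n e s → K * q * (n * (e * s)) ≡ n * (e * q * (s * K))
    shuffle = solve-∀
    rotate : ∀ x p k → x * (p * k) ≡ p * (k * x)
    rotate = solve-∀
    qa : q * a ≡ p * suc N + (r + p)
    qa = eq p′ K′ r
      where
      eq : ∀ p K r → let u = 1 + K + p * (2 + K) in
        (2 + p) * (1 + (u + r)) ≡ (1 + p) * (1 + (K + (1 + (u + r)))) + (r + (1 + p))
      eq = solve-∀
    2p≤ : 2 * p ≤ r * (r + p)
    2p≤ = *-mono-≤ 2≤r (m≤n+m p r)
    pk≤N : p * k ≤ N
    pk≤N = begin
      suc u ≤⟨ s≤s (m≤m+n u r) ⟩
      a ≤⟨ m≤n+m a K′ ⟩
      N ∎

  -- Through Y = C(N,k-2) all quantities become comparable: K B = K δ + (p u + r p′) Y, and p u = K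
  -- p² + p p′. So after the δ blocks there is room for p² Y more, which is what p + q z may use.
  glued-blocks-fit : ∀ C₁ X Y B δ e z → k * B ≡ (u + r) * X → K * X ≡ a * Y → K * C₁ ≡ suc N * Y → k * δ ≡ r * C₁ →
    e * q ≤ δ + p → p + q * z ≤ p * p * Y → (e + z) * q ≤ B
  glued-blocks-fit C₁ X Y B δ e z kB KX KC₁ kδ e-small few = *-cancelˡ-≤ K (begin
    K * ((e + z) * q) ≡⟨ expand K e z q ⟩
    K * (e * q) + K * (q * z) ≤⟨ +-monoˡ-≤ (K * (q * z)) (*-monoʳ-≤ K e-small) ⟩
    K * (δ + p) + K * (q * z) ≡⟨ gather K δ p (q * z) ⟩
    K * δ + K * (p + q * z) ≤⟨ +-monoʳ-≤ (K * δ) (*-monoʳ-≤ K few) ⟩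
    K * δ + K * (p * p * Y) ≤⟨ +-monoʳ-≤ (K * δ) (m≤m+n _ ((p * p′ + r * p′) * Y)) ⟩
    K * δ + (K * (p * p * Y) + (p * p′ + r * p′) * Y) ≡⟨ cong (K * δ +_) (collect p′ K′ r Y) ⟩
    K * δ + (p * u + r * p′) * Y ≡⟨ *-cancelˡ-≡ _ _ k scaled ⟨
    K * B ∎)
    where
    expand : ∀ K e z q → K * ((e + z) * q) ≡ K * (e * q) + K * (q * z)
    expand = solve-∀
    gather : ∀ K d p x → K * (d + p) + K * x ≡ K * d + K * (p + x)
    gather = solve-∀
    collect : ∀ p K r y → (1 + K) * ((1 + p) * (1 + p) * y) + ((1 + p) * p + r * p) * y ≡
      ((1 + p) * (1 + K + p * (2 + K)) + r * p) * y
    collect = solve-∀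
    scaled : k * (K * B) ≡ k * (K * δ + (p * u + r * p′) * Y)
    scaled = begin-equality
      k * (K * B) ≡⟨ rotate k K B ⟩
      K * (k * B) ≡⟨ cong (K *_) kB ⟩
      K * ((u + r) * X) ≡⟨ rotate K (u + r) X ⟩
      (u + r) * (K * X) ≡⟨ cong ((u + r) *_) KX ⟩
      (u + r) * (a * Y) ≡⟨ identity p′ K′ r Y ⟩
      r * (suc N * Y) + k * ((p * u + r * p′) * Y) ≡⟨ cong (λ x → r * x + k * ((p * u + r * p′) * Y)) KC₁ ⟨
      r * (K * C₁) + k * ((p * u + r * p′) * Y) ≡⟨ cong (_+ k * ((p * u + r * p′) * Y)) (rotate r K C₁) ⟩
      K * (r * C₁) + k * ((p * u + r * p′) * Y) ≡⟨ cong (λ x → K * x + k * ((p * u + r * p′) * Y)) kδ ⟨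
      K * (k * δ) + k * ((p * u + r * p′) * Y) ≡⟨ cong (_+ k * ((p * u + r * p′) * Y)) (rotate K k δ) ⟩
      k * (K * δ) + k * ((p * u + r * p′) * Y) ≡⟨ *-distribˡ-+ k (K * δ) _ ⟨
      k * (K * δ + (p * u + r * p′) * Y) ∎
      where
      rotate : ∀ x y z → x * (y * z) ≡ y * (x * z)
      rotate = solve-∀
      identity : ∀ p K r y → let u = 1 + K + p * (2 + K) in
        (u + r) * ((1 + (u + r)) * y) ≡ r * ((1 + (K + (1 + (u + r)))) * y) + (2 + K) * (((1 + p) * u + r * p) * y)
      identity = solve-∀

  C₁ : ℕ
  C₁ = suc N C K

  excess : ∃ λ δ → (2 + N) C k ≡ q * C₁ + δ × k * δ ≡ r * C₁
  excess = δ , sym (m+[n∸m]≡n qC₁≤) , kδ≡rC₁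
    where
    total : k * ((2 + N) C k) ≡ k * (q * C₁) + r * C₁
    total = begin-equality
      k * ((2 + N) C k) ≡⟨ absorption (suc N) K ⟩
      (2 + N) * C₁ ≡⟨ cong (_* C₁) n≡qk+r ⟩
      (q * k + r) * C₁ ≡⟨ eq q k r C₁ ⟩
      k * (q * C₁) + r * C₁ ∎
      where
      eq : ∀ q k r c → (q * k + r) * c ≡ k * (q * c) + r * c
      eq = solve-∀
    qC₁≤ : q * C₁ ≤ (2 + N) C k
    qC₁≤ = *-cancelˡ-≤ k (≤-trans (m≤m+n _ (r * C₁)) (≤-reflexive (sym total)))
    δ = (2 + N) C k ∸ q * C₁
    kδ≡rC₁ : k * δ ≡ r * C₁
    kδ≡rC₁ = +-cancelˡ-≡ (k * (q * C₁)) _ _ (begin-equality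
      k * (q * C₁) + k * δ ≡⟨ *-distribˡ-+ k (q * C₁) δ ⟨
      k * (q * C₁ + δ) ≡⟨ cong (k *_) (m+[n∸m]≡n qC₁≤) ⟩
      k * ((2 + N) C k) ≡⟨ total ⟩
      k * (q * C₁) + r * C₁ ∎)

  K≤N : K ≤ N
  K≤N = ≤-trans (s≤s (m≤m+n K′ (u + r))) (≤-reflexive (sym (+-suc K′ (u + r))))

  top : a * C₁ ≡ suc N * (N C K)
  top = subst (λ x → a * (suc x C K) ≡ suc x * (x C K)) (sym (+-suc K′ (u + r))) (absorption-top K (u + r))

-- By the equation for δ, it is the excess C(n,k) - q C₁; the hypotheses on e hold for ⌈δ / q⌉.
Minor : ℕ → ℕ → ℕ → Set
Minor p′ K′ r = ∀ δ e → k * δ ≡ r * C₁ → e * q ≤ δ + p → CompleteMinor (KneserComplement (2 + N) k) (C₁ + e)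
  where open Parameters p′ K′ r

-- The minor for r = 0, r = 1 and r ≥ 2

minor₀ : ∀ p′ K′ → Minor p′ K′ 0
minor₀ p′ K′ δ e kδ eq≤ with quotient _ _ (Parameters.K≤N p′ K′ 0)
... | s , lower , upper = minor-of-sunflowers lower (subst (λ x → x * suc s ≤ N C K) (sym e≡0) z≤n) upper
  where
  open Parameters p′ K′ 0
  δ≡0 : δ ≡ 0
  δ≡0 = m*n≡0⇒n≡0 k kδ
    where
    m*n≡0⇒n≡0 : ∀ m .{{_ : NonZero m}} {n} → m * n ≡ 0 → n ≡ 0
    m*n≡0⇒n≡0 (suc m) {zero} _ = refl
  small : ∀ e → e * q ≤ p → e ≡ 0
  small zero _ = refl
  small (suc e) le = contradiction (≤-trans (m≤m+n q (e * q)) le) (<⇒≱ (n<1+n p))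
  e≡0 : e ≡ 0
  e≡0 = small e (subst (λ x → e * q ≤ x + p) δ≡0 eq≤)

minor₁ : ∀ p′ K′ → Minor p′ K′ 1
minor₁ p′ K′ δ e kδ eq≤ with quotient _ _ (Parameters.K≤N p′ K′ 1)
... | s , lower , upper = minor-of-sunflowers lower (fit K′ refl) upper
  where
  open Parameters p′ K′ 1
  e-small : suc N * e ≤ C₁ + suc u
  e-small = begin
    -- For r = 1, N + 1 = n - 1 = qk.
    suc N * e ≡⟨ cong (_* e) (suc-injective (trans n≡qk+r (+-comm (q * k) 1))) ⟩
    q * k * e ≡⟨ shuffle q k e ⟩
    k * (e * q) ≤⟨ *-monoʳ-≤ k eq≤ ⟩
    k * (δ + p) ≡⟨ *-distribˡ-+ k δ p ⟩
    k * δ + k * p ≡⟨ cong₂ _+_ (trans kδ (*-identityˡ C₁)) (*-comm k p) ⟩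
    C₁ + suc u ∎
    where
    shuffle : ∀ q k e → q * k * e ≡ k * (e * q)
    shuffle = solve-∀
  fit : ∀ i → K′ ≡ i → e * suc s ≤ N C K
  -- For k = 2 the estimate of `sunflowers-fit` breaks down, as it needs K ≥ 2. Here e ≤ 1, and a
  -- single sunflower fits.
  fit zero refl = begin
    e * suc s ≤⟨ *-monoˡ-≤ (suc s) (≮⇒≥ {1} {e} λ 2≤e → <-irrefl refl (begin-strict
      suc N * 2 ≤⟨ *-monoʳ-≤ (suc N) 2≤e ⟩
      suc N * e ≤⟨ e-small ⟩
      C₁ + suc u ≡⟨ cong (_+ suc u) (nC1≡n (suc N)) ⟩
      suc N + suc u <⟨ +-monoʳ-< (suc N) (s≤s (s≤s (m≤m+n u 1))) ⟩
      suc N + suc N ≡⟨ double (suc N) ⟩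
      suc N * 2 ∎)) ⟩
    1 * suc s ≡⟨ *-comm 1 (suc s) ⟩
    suc s * 1 ≤⟨ lower ⟩
    N ≡⟨ nC1≡n N ⟨
    N C 1 ∎
    where
    double : ∀ x → x + x ≡ x * 2
    double = solve-∀
  fit (suc i) refl = sunflowers-fit i u C₁ (N C K) e (suc s)
    (subst₂ (λ x y → x * C₁ ≡ suc y * (N C K)) (cong suc (+-comm u 1)) shape top)
    (subst (λ x → suc x ≤ C₁) shape (n≤nCj (s≤s z≤n) (s≤s K≤N)))
    (subst (λ x → suc x * e ≤ C₁ + suc u) shape e-small)
    (subst (suc s * K ≤_) shape lower)
    where
    shape : N ≡ K + suc u
    shape = trans (+-suc K′ (u + 1)) (cong (K +_) (+-comm u 1))

-- The sunflowers have ⌊pk / K⌋ petals, and N = qk + r′, so q blocks fit and leave r′ < K points.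
-- `reach` says that at most b points lie outside a sunflower with x covered points, and `few` that
-- blocks inside b points are rare enough.
glue : ∀ p′ K′ r′ → let open Parameters p′ K′ (2 + r′) in 2 + r′ ≤ K → (b : ℕ) →
  (∀ x → K ≤ x → p * k < x + K → N ≤ x + b) → p + q * (b C k) ≤ p * p * (N C K′) → Minor p′ K′ (2 + r′)
glue p′ K′ r′ r≤K b reach few δ e kδ eq≤ with quotient _ _ (≤-trans (n≤1+n (suc K′)) (m≤m+n (2 + K′) (p′ * (2 + K′))))
... | s , lower , upper = minor-of-glued-classes sK≤N
  (glued-sunflowers-fit C₁ X e (suc s) (s≤s (s≤s z≤n)) r≤K top C₁-large e-small lower)
  q (≤-trans (m≤m+n (q * k) r′) (≤-reflexive shape))
  (subst (_< q * k + K) shape (+-monoʳ-< (q * k) (≤-trans (n≤1+n (suc r′)) r≤K)))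
  (glued-blocks-fit C₁ X Y (N C k) δ e _ kB (descend K′ a) (absorption N K′) kδ eq≤
    (≤-trans (+-monoʳ-≤ p (*-monoʳ-≤ q (C-monoˡ k (m≤n+o⇒m∸n≤o N (suc s * K) (reach (suc s * K) (m≤m+n K (s * K)) upper))))) few))
  where
  open Parameters p′ K′ (2 + r′)
  r = 2 + r′
  X = N C K
  Y = N C K′
  shape : q * k + r′ ≡ N
  shape = suc-injective (suc-injective (trans (sym (trans (+-suc (q * k) (suc r′)) (cong suc (+-suc (q * k) r′)))) (sym n≡qk+r)))
  sK≤N : suc s * K ≤ N
  sK≤N = ≤-trans lower (≤-trans (m≤n+m (p * k) k) (≤-trans (m≤m+n (q * k) r′) (≤-reflexive shape)))
  k≤N : 1 + K ≤ N
  k≤N = ≤-trans (m≤m+n k (p * k)) (≤-trans (m≤m+n (q * k) r′) (≤-reflexive shape))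
  C₁-large : suc N * N ≤ 2 * C₁
  C₁-large = n[n-1]≤2nCj (≤-trans (s≤s (s≤s z≤n)) r≤K) k≤N
  e-small : k * (e * q) ≤ r * C₁ + k * p
  e-small = ≤-trans (*-monoʳ-≤ k eq≤) (≤-reflexive (trans (*-distribˡ-+ k δ p) (cong (_+ k * p) kδ)))
  kB : k * (N C k) ≡ (u + r) * X
  kB = subst (λ x → k * (x C k) ≡ (u + r) * (x C K)) (sym (+-suc K′ (u + r))) (descend K (u + r))

-- ⌊(q - 1)k / (k - 1)⌋ petals suffice, except that n = 8, k = 3 needs a second petal.
minor₂ : ∀ p′ K′ r′ → 2 + r′ ≤ suc K′ → Minor p′ K′ (2 + r′)
minor₂ p′ zero r′ (s≤s ())
-- Here δ = 14 and e can be 7. With one petal, C(4,3) = 4 blocks might miss it, and (7 + 4) 2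
-- exceeds C(6,3) = 20. Two petals leave only 2 points, so no block misses them, and 7 · 2 ≤ C(6,2)
-- = 15.
minor₂ zero (suc zero) zero _ δ e kδ eq≤ =
  minor-of-glued-classes {s = 1} (s≤s (s≤s (s≤s (s≤s z≤n)))) e≤ 2 ≤-refl (m≤m+n 7 1)
    (≤-trans (≤-reflexive (cong (_* 2) (+-identityʳ e))) (≤-trans e≤ (m≤m+n 15 5)))
  where
  e≤ : e * 2 ≤ 15
  e≤ = ≤-trans eq≤ (+-monoˡ-≤ 1 (≤-reflexive (*-cancelˡ-≡ δ 14 3 kδ)))
minor₂ zero (suc zero) (suc r′) (s≤s (s≤s ()))
minor₂ zero (suc (suc i)) r′ r≤K = glue zero (2 + i) r′ r≤K b reach few
  where
  open Parameters zero (2 + i) (2 + r′)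
  b = (2 + i) + (3 + r′)
  reach : ∀ x → K ≤ x → p * k < x + K → N ≤ x + b
  reach x K≤x _ = ≤-trans (≤-reflexive (shape i r′)) (+-monoˡ-≤ b K≤x)
    where
    shape : ∀ i r → 2 + i + (1 + (3 + i + 0 + (2 + r))) ≡ 3 + i + (2 + i + (3 + r))
    shape = solve-∀
  few : 1 + 2 * (b C k) ≤ 1 * (N C (2 + i))
  few = ≤-trans (half-blocks-miss i (2 + r′) (s≤s (s≤s z≤n)) r≤K)
    (≤-reflexive (trans (cong (_C (2 + i)) (shape i r′)) (sym (*-identityˡ _))))
    where
    shape : ∀ i r → 2 + i + 1 + (2 + i + (3 + r)) ≡ 2 + i + (1 + (3 + i + 0 + (2 + r)))
    shape = solve-∀
minor₂ (suc p″) (suc i) r′ r≤K = glue (suc p″) (suc i) r′ r≤K b reach few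
  where
  open Parameters (suc p″) (suc i) (2 + r′)
  b = suc i + suc (i + (2 + r′))
  Y = N C suc i
  z = b C k
  reach : ∀ x → K ≤ x → p * k < x + K → N ≤ x + b
  -- The petals cover at least pk - K + 1 points, and b is N minus this number.
  reach x _ upper = s≤s⁻¹ (begin
    suc N ≡⟨ shape i u r′ ⟩
    2 + u + (i + 3 + r′) ≤⟨ +-monoˡ-≤ (i + 3 + r′) upper ⟩
    x + K + (i + 3 + r′) ≡⟨ shape′ i x r′ ⟩
    suc (x + b) ∎)
    where
    shape : ∀ i u r → 1 + (1 + i + (1 + (u + (2 + r)))) ≡ 2 + u + (i + 3 + r)
    shape = solve-∀
    shape′ : ∀ i x r → x + (2 + i) + (i + 3 + r) ≡ 1 + (x + (1 + i + (1 + (i + (2 + r)))))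
    shape′ = solve-∀
  z<Y : z < Y
  z<Y = ≤-trans (few-blocks-miss i (2 + r′) r≤K) (C-monoˡ (suc i)
    (≤-trans (m≤m+n _ (p″ * k)) (≤-reflexive (shape i p″ r′))))
    where
    shape : ∀ i p r → 1 + i + 4 + (1 + i + (1 + (i + (2 + r)))) + p * (3 + i) ≡
      1 + i + (1 + (2 + i + (3 + i + p * (3 + i)) + (2 + r)))
    shape = solve-∀
  few : p + q * z ≤ p * p * Y
  few = begin
    p + q * z ≤⟨ +-monoˡ-≤ (q * z) (n≤1+n p) ⟩
    q + q * z ≡⟨ *-suc q z ⟨
    q * suc z ≤⟨ *-mono-≤ q≤pp z<Y ⟩
    p * p * Y ∎
    where
    square : ∀ p → 3 + p + (1 + 3 * p + p * p) ≡ (2 + p) * (2 + p)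
    square = solve-∀
    -- This needs q ≥ 3. For q = 2 one has p = 1, which is why `half-blocks-miss` carries the factor
    -- 2.
    q≤pp : q ≤ p * p
    q≤pp = ≤-trans (m≤m+n q (1 + 3 * p″ + p″ * p″)) (≤-reflexive (square p″))

minor : ∀ p′ K′ r → r ≤ suc K′ → Minor p′ K′ r
minor p′ K′ zero _ = minor₀ p′ K′
minor p′ K′ (suc zero) _ = minor₁ p′ K′
minor p′ K′ (suc (suc r′)) r≤K = minor₂ p′ K′ r′ r≤K

coloring-and-minor : ∀ p′ K′ r → r ≤ suc K′ → let open Parameters p′ K′ r in
  ∃ λ t → Colorable (KneserComplement (2 + N) k) t × CompleteMinor (KneserComplement (2 + N) k) t
coloring-and-minor p′ K′ r r≤K = C₁ + e
  , colorable q (C₁ + e) (≤-trans (m≤m+n (q * k) r) (≤-reflexive (sym n≡qk+r))) enough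
  , minor p′ K′ r r≤K δ e kδ (m/n*n≤m (δ + p) q)
  where
  open Parameters p′ K′ r
  δ = proj₁ excess
  total = proj₁ (proj₂ excess)
  kδ = proj₂ (proj₂ excess)
  -- This is ⌈δ / q⌉, as p = q - 1.
  e = (δ + p) / q
  δ≤eq : δ ≤ e * q
  δ≤eq = +-cancelˡ-≤ p _ _ (begin
    p + δ ≡⟨ +-comm p δ ⟩
    δ + p ≡⟨ m≡m%n+[m/n]*n (δ + p) q ⟩
    (δ + p) % q + e * q ≤⟨ +-monoˡ-≤ (e * q) (s≤s⁻¹ (m%n<n (δ + p) q)) ⟩
    p + e * q ∎)
  enough : (2 + N) C k ≤ (C₁ + e) * q
  enough = begin
    (2 + N) C k ≡⟨ total ⟩
    q * C₁ + δ ≤⟨ +-mono-≤ (≤-reflexive (*-comm q C₁)) δ≤eq ⟩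
    C₁ * q + e * q ≡⟨ *-distribʳ-+ q C₁ e ⟨
    (C₁ + e) * q ∎

division : ∀ n k .{{_ : NonZero k}} → 2 * k ≤ n → ∃ λ p′ → n ≡ (2 + p′) * k + n % k
division n k 2k≤n = n / k ∸ 2 , (begin-equality
  n ≡⟨ m≡m%n+[m/n]*n n k ⟩
  n % k + n / k * k ≡⟨ +-comm (n % k) _ ⟩
  n / k * k + n % k ≡⟨ cong (λ x → x * k + n % k) (m+[n∸m]≡n 2≤n/k) ⟨
  (2 + (n / k ∸ 2)) * k + n % k ∎)
  where
  2≤n/k : 2 ≤ n / k
  2≤n/k = ≤-trans (≤-reflexive (sym (m*n/n≡m 2 k))) (/-monoˡ-≤ k 2k≤n)

theorem1 : (n k : ℕ) → 2 * k + 1 ≥ 5 → n ≥ 2 * k + 1 →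
    (h χ : ℕ) → IsHadwigerNumber (KneserComplement n k) h →
    IsChromaticNumber (KneserComplement n k) χ → χ ≤ h
theorem1 n (suc zero) (s≤s (s≤s (s≤s ()))) _
theorem1 n zero (s≤s ()) _
theorem1 n k@(suc (suc K′)) _ n≥ h χ (_ , h-max) (_ , χ-min)
  with division n k (≤-trans (m≤m+n (2 * k) 1) n≥)
... | p′ , n≡ =
  -- The same t bounds χ from above and h from below.
  let t , coloring , completeMinor = realised in ≤-trans (χ-min t coloring) (h-max t completeMinor)
  where
  realised : ∃ λ t → Colorable (KneserComplement n k) t × CompleteMinor (KneserComplement n k) t
  realised = subst (λ m → ∃ λ t → Colorable (KneserComplement m k) t × CompleteMinor (KneserComplement m k) t)
    (trans (Parameters.n≡qk+r p′ K′ (n % k)) (sym n≡)) (coloring-and-minor p′ K′ (n % k) (s≤s⁻¹ (m%n<n n k)))
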